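{- Let $u,v\in S_{\mathbb{Z}_+}$. For all $i\in\mathbb{Z}$, \[\max_{w\,:\,\overleftarrow{c_{u,v}^w}\neq 0} I_i(\mathcal{RW}(w))=I_i(\mathcal{RW}(u))+I_i(\mathcal{RW}(v)).\] In particular, if for some $i$, $I_i(\mathcal{RW}(w))>I_i(\mathcal{RW}(u))+I_i(\mathcal{RW}(v))$, then $\overleftarrow{c_{u,v}^w}=0$.
   Context: $S_{\mathbb{Z}}$: bijections of $\mathbb{Z}$ fixing all but finitely many integers; $S_{\mathbb{Z}_+}$: those fixing every integer $\le 0$. $s_i=(i\ i{+}1)$; $\mathcal{RW}(w)$ is the set of reduced words $(w_1,\dots,w_k)$ of $w$ ($w=s_{w_1}\cdots s_{w_k}$, $k$ minimal). For an integer word $t=(t_1,\dots,t_k)$, a bottom row is a weakly increasing $b\in\mathbb{Z}^k$ with $b_j\le t_j$ and $b_j<b_{j+1}$ whenever $t_j<t_{j+1}$; $\overleftarrow{\mathfrak{S}}_w=\sum_{t\in\mathcal{RW}(w)}\sum_b x_{b_1}\cdots x_{b_k}$ (power series in $x_i$, $i\in\mathbb{Z}$), and the back-stable structure constants are defined by $\overleftarrow{\mathfrak{S}}_u\overleftarrow{\mathfrak{S}}_v=\sum_w\overleftarrow{c_{u,v}^w}\overleftarrow{\mathfrak{S}}_w$. For a word $p=(p_1,\dots,p_k)$, $I(p)$ is the length of its longest strictly increasing suffix ($0$ for the empty word), and $I_i(p)=I(p)$ if $k\ge1$ and $p_k\le i$, $I_i(p)=0$ otherwise. For a set $X$ of words,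 $I_i(X)=\max_{p\in X}I_i(p)$. -}

module Defs where

open import Data.Bool using (Bool; true; false; _∧_; not; if_then_else_)
open import Data.Nat as ℕ using (ℕ; zero; suc; _∸_; _⊔_)
open import Data.Integer as ℤ using (ℤ; +_; _≤ᵇ_; _≟_)
open import Data.List using (List; []; _∷_; _++_; length; map; concatMap; upTo; replicate; reverse; last; filterᵇ; foldr)
open import Data.Nat.ListAction using (sum)
open import Data.Maybe using (Maybe; just; nothing)
open import Data.Product using (_×_; _,_; proj₁; proj₂)
open import Data.List.Membership.Propositional using (_∈_; _∉_)
open import Relation.Nullary.Decidable using (⌊_⌋)
open import Relation.Binary.PropositionalEquality using (_≡_)

record Perm : Set where
  field
    fun     : ℤ → ℤ
    inv     : ℤ → ℤ
    inv∘fun : ∀ j → inv (fun j) ≡ j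
    fun∘inv : ∀ j → fun (inv j) ≡ j
    support : List ℤ
    fixes   : ∀ j → j ∉ support → fun j ≡ j
open Perm public

_≈ₚ_ : Perm → Perm → Set
u ≈ₚ w = ∀ j → fun u j ≡ fun w j

InSZ+ : Perm → Set
InSZ+ w = ∀ j → j ℤ.≤ ℤ.0ℤ → fun w j ≡ j

Word : Set
Word = List ℤ

_<ᵇ_ : ℤ → ℤ → Bool
a <ᵇ b = (a ℤ.+ ℤ.1ℤ) ≤ᵇ b

_==_ : ℤ → ℤ → Bool
a == b = ⌊ a ≟ b ⌋

s : ℤ → ℤ → ℤ
s i j = if j == i then i ℤ.+ ℤ.1ℤ else (if j == (i ℤ.+ ℤ.1ℤ) then i else j)

prod : Word → ℤ → ℤ
prod []      j = j
prod (a ∷ t) j = s a (prod t j)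

IsWordOf : Perm → Word → Set
IsWordOf w t = ∀ j → prod t j ≡ fun w j

IsReducedWord : Perm → Word → Set
IsReducedWord w t = IsWordOf w t × (∀ t' → IsWordOf w t' → length t ℕ.≤ length t')

isBottom : Word → List ℤ → Bool
isBottom []             []             = true
isBottom (t ∷ [])       (b ∷ [])       = b ≤ᵇ t
isBottom (t ∷ t' ∷ ts)  (b ∷ b' ∷ bs)  =
  (b ≤ᵇ t) ∧ (b ≤ᵇ b') ∧ (if t <ᵇ t' then b <ᵇ b' else true) ∧ isBottom (t' ∷ ts) (b' ∷ bs)
isBottom _              _              = false

-- Monomials x_{b1} ⋯ x_{bk} are represented by weakly increasing lists b.
-- Given an exact enumeration rw w of RW(w), the coefficient of the monomial
-- m in ←𝔖_w is the number of reduced words t of w having m as bottom row.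
coeffS : (Perm → List Word) → Perm → List ℤ → ℕ
coeffS rw w m = length (filterᵇ (λ t → isBottom t m) (rw w))

runs : List ℤ → List (ℤ × ℕ)
runs []      = []
runs (a ∷ m) with runs m
... | []             = (a , 1) ∷ []
... | (b , k) ∷ rs   = if a == b then (b , suc k) ∷ rs else (a , 1) ∷ (b , k) ∷ rs

splitRuns : List (ℤ × ℕ) → List (List ℤ × List ℤ)
splitRuns []             = ([] , []) ∷ []
splitRuns ((a , k) ∷ rs) =
  concatMap (λ j → map (λ xy → (replicate j a ++ proj₁ xy , replicate (k ∸ j) a ++ proj₂ xy))
                       (splitRuns rs))
            (upTo (suc k))

prodCoeff : (List ℤ → ℕ) → (List ℤ → ℕ) → List ℤ → ℕ
prodCoeff f g m = sum (map (λ xy → f (proj₁ xy) ℕ.* g (proj₂ xy)) (splitRuns (runs m)))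

sumℤ : List ℤ → ℤ
sumℤ = foldr ℤ._+_ ℤ.0ℤ

linCoeff : (Perm → List Word) → List (Perm × ℤ) → List ℤ → ℤ
linCoeff rw L m = sumℤ (map (λ wc → proj₂ wc ℤ.* (+ coeffS rw (proj₁ wc) m)) L)

decPrefix : List ℤ → ℕ
decPrefix []           = 0
decPrefix (a ∷ [])     = 1
decPrefix (a ∷ b ∷ r)  = if b <ᵇ a then suc (decPrefix (b ∷ r)) else 1

I : Word → ℕ
I p = decPrefix (reverse p)

Iᵢ : ℤ → Word → ℕ
Iᵢ i p with last p
... | nothing = 0
... | just pk = if pk ≤ᵇ i then I p else 0

IᵢSet : ℤ → List Word → ℕ
IᵢSet i X = foldr (λ p n → Iᵢ i p ⊔ n) 0 X

{-# OPTIONS --safe #-}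
module Submission where

open import Defs
open import Data.Bool using (Bool; true; false; if_then_else_)
open import Data.Bool.Properties using (T-≡)
open import Data.Empty using (⊥-elim)
open import Data.Integer as ℤ using (ℤ; 0ℤ; 1ℤ; _+_; _*_; -_; _-_; _^_; _≤ᵇ_; ∣_∣)
import Data.Integer.Properties as ℤ
open import Data.Integer.Tactic.RingSolver using (solve-∀)
open import Data.List using (List; []; _∷_; _++_; length; map; reverse; last; _ʳ++_; filterᵇ; concatMap; replicate; upTo; applyUpTo)
open import Data.List.Extrema.Nat using (max; xs≤max)
open import Data.List.Membership.Propositional using (_∈_; _∉_)
open import Data.List.Membership.Propositional.Properties using (∈-++⁺ˡ; ∈-++⁺ʳ; ∈-concatMap⁺)
open import Data.List.Properties using (++-assoc; ++-identityʳ; length-++; length-map; length-replicate; length-reverse; map-++; map-∘; map-cong; map-id; map-id-local; reverse-++; reverse-involutive; reverse-map; unfold-reverse; ʳ++-defn; ≡-dec)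
open import Data.List.Relation.Unary.All as All using (All; []; _∷_)
import Data.List.Relation.Unary.All.Properties as All
open import Data.List.Relation.Unary.AllPairs using (AllPairs; []; _∷_)
open import Data.List.Relation.Unary.Any as Any using (Any; here; there)
import Data.List.Relation.Unary.Any.Properties as Any
open import Data.List.Relation.Unary.Linked as Linked using (Linked; []; [-]; _∷_)
open import Data.List.Relation.Unary.Unique.Propositional using (Unique)
open import Data.Maybe using (just; nothing)
open import Data.Nat as ℕ using (ℕ; zero; suc; z≤n; s≤s; _∸_)
open import Data.Nat.Induction using (<-rec)
open import Data.Nat.ListAction using (sum)
open import Data.Nat.ListAction.Properties using (sum-++)
import Data.Nat.Properties as ℕ
import Data.Nat.Tactic.RingSolver as ℕ-Ring
open import Data.Product using (∃; ∃₂; _×_; _,_; proj₁; proj₂)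
open import Data.Sum using (inj₁; inj₂; [_,_]′)
open import Function using (_∘_; Equivalence)
open import Relation.Binary.PropositionalEquality using (_≡_; _≢_; refl; sym; trans; cong; cong₂; subst; subst₂)
open import Relation.Nullary using (Dec; ¬_; yes; no; ¬?; _×-dec_)
import Algebra.Properties.AbelianGroup ℤ.+-0-abelianGroup as ℤ-Group

-- Summing over the reduced words of w that end in a fixed word r gives the iterated divided
-- difference ∂_{r₁} ⋯ ∂_{r_m} 𝔖_w (Fomin–Stanley), so I_i(RW(w)) is the largest length of a strictly
-- increasing r with letters ≤ i such that ∂_r 𝔖_w ≠ 0.  Call f of degree ≤ p if ∂_r f = 0 for all such
-- r of length > p, and let its leading coefficient be the sum of ∂_r f over the r of length p.  Since
-- s_k f = f + (x_{k+1} - x_k) ∂_k f, where x_{k+1} - x_k has degree 1 and leading coefficient 1 with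
-- respect to the letters < k, the Leibniz rule shows by induction on i that degrees add and leading
-- coefficients multiply.
--
-- Upper bound: if I_i(RW(w)) exceeds the degree of 𝔖_u 𝔖_v, take a reduced word of w with a longest
-- increasing suffix; its divided difference kills 𝔖_u 𝔖_v, but sends Σ c_w' 𝔖_w' to c_w, so c_w = 0.
-- Equality: the leading coefficients of 𝔖_u and 𝔖_v are nonempty sums of Schubert polynomials, hence
-- their product is positive at positive points; were all I_i(RW(w)) with c_w ≠ 0 smaller, it would vanish.
--
-- All of this takes place after setting x_j = 0 for j below a bound, and power series are replaced by
-- their values at positive points with pairwise distinct coordinates, where ∂_k is determined by
-- f - s_k f = (x_k - x_{k+1}) ∂_k f.

-- Divided differences of Schubert polynomials

-- Linear functionals on formal sums of words; those satisfying Nil factor through the nilCoxeter algebra.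
Functional : Set
Functional = List ℕ → ℤ

infix 4 _≐_
_≐_ : Functional → Functional → Set
χ ≐ ψ = ∀ t → χ t ≡ ψ t

≐-sym : ∀ {χ ψ} → χ ≐ ψ → ψ ≐ χ
≐-sym e t = sym (e t)

infixr 5 _⟫_
_⟫_ : ∀ {χ ψ φ} → χ ≐ ψ → ψ ≐ φ → χ ≐ φ
(e ⟫ e′) t = trans (e t) (e′ t)

record Nil (χ : Functional) : Set where
  field
    square : ∀ p a q → χ (p ++ a ∷ a ∷ q) ≡ 0ℤ
    comm   : ∀ p {a b} q → 2 ℕ.+ a ℕ.≤ b → χ (p ++ a ∷ b ∷ q) ≡ χ (p ++ b ∷ a ∷ q)
    braid  : ∀ p a q → χ (p ++ a ∷ suc a ∷ a ∷ q) ≡ χ (p ++ suc a ∷ a ∷ suc a ∷ q)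
open Nil

-- ⟨M a x χ, P⟩ = ⟨χ, (1 + x u_a) P⟩
M : ℕ → ℤ → Functional → Functional
M a x χ t = χ t + x * χ (a ∷ t)

M-cong : ∀ a x {χ ψ} → χ ≐ ψ → M a x χ ≐ M a x ψ
M-cong a x e t = cong₂ (λ p q → p + x * q) (e t) (e (a ∷ t))

M-nil : ∀ a x {χ} → Nil χ → Nil (M a x χ)
square (M-nil a x N) p b q = trans (cong₂ (λ u v → u + x * v) (square N p b q) (square N (a ∷ p) b q)) (trans (ℤ.+-identityˡ _) (ℤ.*-zeroʳ x))
comm   (M-nil a x N) p q h = cong₂ (λ u v → u + x * v) (comm N p q h) (comm N (a ∷ p) q h)
braid  (M-nil a x N) p b q = cong₂ (λ u v → u + x * v) (braid N p b q) (braid N (a ∷ p) b q)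

M-zero : ∀ a χ → M a 0ℤ χ ≐ χ
M-zero a χ t = trans (cong (λ z → χ t + z) (ℤ.*-zeroˡ (χ (a ∷ t)))) (ℤ.+-identityʳ _)

M-add : ∀ a x y {χ} → Nil χ → M a x (M a y χ) ≐ M a (x + y) χ
M-add a x y {χ} N t rewrite square N [] a t = ring x y (χ t) (χ (a ∷ t))
  where
  ring : ∀ x y p q → (p + y * q) + x * (q + y * 0ℤ) ≡ p + (x + y) * q
  ring = solve-∀

M-cancel : ∀ a x {χ} → Nil χ → M a (- x) (M a x χ) ≐ χ
M-cancel a x {χ} N t =
  trans (M-add a (- x) x N t) (trans (cong (λ z → M a z χ t) (ℤ.+-inverseˡ x)) (M-zero a χ t))

M-comm-same : ∀ a x y {χ} → Nil χ → M a x (M a y χ) ≐ M a y (M a x χ)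
M-comm-same a x y {χ} N t rewrite square N [] a t = ring x y (χ t) (χ (a ∷ t))
  where
  ring : ∀ x y p q → (p + y * q) + x * (q + y * 0ℤ) ≡ (p + x * q) + y * (q + x * 0ℤ)
  ring = solve-∀

M-comm : ∀ {a b} x y {χ} → Nil χ → 2 ℕ.+ a ℕ.≤ b → M a x (M b y χ) ≐ M b y (M a x χ)
M-comm {a} {b} x y {χ} N h t rewrite comm N [] {a} {b} t h = ring x y (χ t) (χ (a ∷ t)) (χ (b ∷ t)) (χ (b ∷ a ∷ t))
  where
  ring : ∀ x y p q r s → (p + y * r) + x * (q + y * s) ≡ (p + x * q) + y * (r + x * s)
  ring = solve-∀

-- After expansion the squares vanish and the cubic terms agree by one braid relation. `M` acts
-- contravariantly: the innermost `M` is the leftmost factor of the product.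
yang-baxter : ∀ a x y {χ} → Nil χ →
  M a x (M (suc a) (x + y) (M a y χ)) ≐ M (suc a) y (M a (x + y) (M (suc a) x χ))
yang-baxter a x y {χ} N t
  rewrite square N [] a t | square N [] (suc a) t | braid N [] a t
  = ring x y (χ t) (χ (a ∷ t)) (χ (suc a ∷ t)) (χ (a ∷ suc a ∷ t)) (χ (suc a ∷ a ∷ t)) (χ (suc a ∷ a ∷ suc a ∷ t))
  where
  ring : ∀ x y p a b ab ba bab →
    (p + y * a) + (x + y) * (b + y * ab) + x * ((a + y * 0ℤ) + (x + y) * (ba + y * bab))
    ≡ (p + x * b) + (x + y) * (a + x * ba) + y * ((b + x * 0ℤ) + (x + y) * (ab + x * bab))
  ring = solve-∀

-- Left multiplication by A_j(x) = (1 + x u_{j+r-1}) ⋯ (1 + x u_j), acting on functionals.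
Ad : ℕ → ℕ → ℤ → Functional → Functional
Ad zero    j x χ = χ
Ad (suc r) j x χ = M j x (Ad r (suc j) x χ)

Ad-cong : ∀ r j x {χ ψ} → χ ≐ ψ → Ad r j x χ ≐ Ad r j x ψ
Ad-cong zero    j x e = e
Ad-cong (suc r) j x e = M-cong j x (Ad-cong r (suc j) x e)

Ad-nil : ∀ r j x {χ} → Nil χ → Nil (Ad r j x χ)
Ad-nil zero    j x N = N
Ad-nil (suc r) j x N = M-nil j x (Ad-nil r (suc j) x N)

Ad-M-comm : ∀ r {a j} x y {χ} → Nil χ → 2 ℕ.+ a ℕ.≤ j → Ad r j x (M a y χ) ≐ M a y (Ad r j x χ)
Ad-M-comm zero    x y N h t = refl
Ad-M-comm (suc r) {a} {j} x y N h =
  M-cong j x (Ad-M-comm r x y N (ℕ.m≤n⇒m≤1+n h))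
  ⟫ ≐-sym (M-comm y x (Ad-nil r (suc j) x N) h)

-- Induction on `r`. Slide 1 + x u_j through A_{j+2}(y), split 1 + y u_j as (1 + (y - x) u_j)(1 + x
-- u_j), and apply Yang-Baxter; what remains is the commutation of A_{j+1}(x) and A_{j+1}(y).
Ad-comm : ∀ r j x y {χ} → Nil χ → Ad r j y (Ad r j x χ) ≐ Ad r j x (Ad r j y χ)
Ad-comm zero          j x y N t = refl
Ad-comm (suc zero)    j x y N = M-comm-same j y x N
Ad-comm (suc (suc r)) j x y {χ} N =
  M-cong j y (M-cong j′ y (Ad-M-comm r y x (Ad-nil (suc r) j′ x N) ℕ.≤-refl))
  ⟫ split
  ⟫ M-cong j x (yb ⟫ M-cong j′ x (λ t → cong (λ z → M j z (M j′ (y - x) ψ) t) (sub y x)))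
  ⟫ M-cong j x (M-cong j′ x (M-cong j y (drop (Ad-comm (suc r) j′ x y N)) ⟫ ≐-sym (Ad-M-comm r x y (Ad-nil (suc r) j′ y N) ℕ.≤-refl)))
  where
  j′ = suc j
  ψ = Ad r (suc j′) y (Ad (suc r) j′ x χ)
  Nψ : Nil ψ
  Nψ = Ad-nil r (suc j′) y (Ad-nil (suc r) j′ x N)
  sub : ∀ y x → (y - x) + x ≡ y
  sub = solve-∀
  sub′ : ∀ y x → x + (y - x) ≡ y
  sub′ = solve-∀
  sub″ : ∀ y x → (- x) + y ≡ y - x
  sub″ = solve-∀
  split : M j y (M j′ y (M j x ψ)) ≐ M j x (M j (y - x) (M j′ y (M j x ψ)))
  split t = trans (cong (λ z → M j z (M j′ y (M j x ψ)) t) (sym (sub′ y x)))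
                  (sym (M-add j x (y - x) (M-nil j′ y (M-nil j x Nψ)) t))
  yb : M j (y - x) (M j′ y (M j x ψ)) ≐ M j′ x (M j ((y - x) + x) (M j′ (y - x) ψ))
  yb t = trans (cong (λ z → M j (y - x) (M j′ z (M j x ψ)) t) (sym (sub y x))) (yang-baxter j (y - x) x Nψ t)
  -- The induction hypothesis with 1 + x u_{j+1} cancelled on the right: A_{j+1}(x) A_{j+2}(y) (1 +
  -- (y - x) u_{j+1}) = A_{j+1}(y) A_{j+2}(x).
  drop : Ad (suc r) j′ y (Ad (suc r) j′ x χ) ≐ Ad (suc r) j′ x (Ad (suc r) j′ y χ) →
         M j′ (y - x) ψ ≐ Ad r (suc j′) x (Ad (suc r) j′ y χ)
  drop ih = (λ t → cong (λ z → M j′ z ψ t) (sym (sub″ y x)))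
       ⟫ ≐-sym (M-add j′ (- x) y Nψ)
       ⟫ M-cong j′ (- x) ih
       ⟫ M-cancel j′ x (Ad-nil r (suc j′) x (Ad-nil (suc r) j′ y N))

-- Sch r j x χ t = ⟨χ, A_j(x_j) ⋯ A_{j+r-1}(x_{j+r-1}) u_t⟩
Sch : ℕ → ℕ → (ℕ → ℤ) → Functional → Functional
Sch zero    j x χ = χ
Sch (suc r) j x χ = Sch r (suc j) x (Ad (suc r) j (x j) χ)

Sch-cong : ∀ r j x {χ ψ} → χ ≐ ψ → Sch r j x χ ≐ Sch r j x ψ
Sch-cong zero    j x e = e
Sch-cong (suc r) j x e = Sch-cong r (suc j) x (Ad-cong (suc r) j (x j) e)

Sch-cong-x : ∀ r j {x y} χ → (∀ k → j ℕ.≤ k → x k ≡ y k) → Sch r j x χ ≐ Sch r j y χ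
Sch-cong-x zero    j χ e t = refl
Sch-cong-x (suc r) j {x} {y} χ e t rewrite e j ℕ.≤-refl =
  Sch-cong-x r (suc j) _ (λ k h → e k (ℕ.≤-trans (ℕ.n≤1+n j) h)) t

Sch-nil : ∀ r j x {χ} → Nil χ → Nil (Sch r j x χ)
Sch-nil zero    j x N = N
Sch-nil (suc r) j x N = Sch-nil r (suc j) x (Ad-nil (suc r) j (x j) N)

Sch-M-comm : ∀ r {a j} x y {χ} → Nil χ → 2 ℕ.+ a ℕ.≤ j → Sch r j x (M a y χ) ≐ M a y (Sch r j x χ)
Sch-M-comm zero    x y N h t = refl
Sch-M-comm (suc r) {a} {j} x y N h =
  Sch-cong r (suc j) x (Ad-M-comm (suc r) (x j) y N h)
  ⟫ Sch-M-comm r x y (Ad-nil (suc r) j (x j) N) (ℕ.m≤n⇒m≤1+n h)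

swap : ℕ → ℕ → ℕ
swap zero    zero          = 1
swap zero    (suc zero)    = 0
swap zero    (suc (suc j)) = suc (suc j)
swap (suc i) zero          = zero
swap (suc i) (suc j)       = suc (swap i j)

swap-self : ∀ i → swap i i ≡ suc i
swap-self zero    = refl
swap-self (suc i) = cong suc (swap-self i)

swap-suc : ∀ i → swap i (suc i) ≡ i
swap-suc zero    = refl
swap-suc (suc i) = cong suc (swap-suc i)

swap-< : ∀ i {j} → j ℕ.< i → swap i j ≡ j
swap-< (suc i) {zero}  h = refl
swap-< (suc i) {suc j} (ℕ.s≤s h) = cong suc (swap-< i h)

swap-> : ∀ i {j} → 2 ℕ.+ i ℕ.≤ j → swap i j ≡ j
swap-> zero    {suc (suc j)} h = refl
swap-> zero    {suc zero} (ℕ.s≤s ())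
swap-> (suc i) {suc j} (ℕ.s≤s h) = cong suc (swap-> i h)

swap-involutive : ∀ i j → swap i (swap i j) ≡ j
swap-involutive zero    zero          = refl
swap-involutive zero    (suc zero)    = refl
swap-involutive zero    (suc (suc j)) = refl
swap-involutive (suc i) zero          = refl
swap-involutive (suc i) (suc j)       = cong suc (swap-involutive i j)

-- Because A_{i+1}(x_{i+1}) = A_i(x_{i+1})(1 - x_{i+1} u_i) and u_i commutes with the later factors,
-- the product is S (1 - x_{i+1} u_i) with S symmetric in x_i and x_{i+1}. The difference is thus
-- (x_i - x_{i+1}) S u_i, and u_i² = 0 identifies S u_i with the full product times u_i. The bound
-- on `n` puts both variables among the `r` variables present.
Sch-divided-difference : ∀ r j n x {χ} → Nil χ → suc n ℕ.< r → ∀ t → let i = n ℕ.+ j in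
  Sch r j x χ t - Sch r j (λ k → x (swap i k)) χ t ≡ (x i - x (suc i)) * Sch r j x χ (i ∷ t)
Sch-divided-difference (suc zero) j n x N (ℕ.s≤s ()) t
Sch-divided-difference (suc (suc r)) j zero x {χ} N h t =
  trans (cong₂ _-_ (unfold x t) (trans (unfold x′ t) (cong₂ (λ p q → p - x (swap j (suc j)) * q) (sym (same t)) (sym (same (j ∷ t))))))
  (trans (cong (λ z → (Q x t - x (suc j) * Q x (j ∷ t)) - (Q x t - x z * Q x (j ∷ t))) (swap-suc j))
  (trans (ring (Q x t) (Q x (j ∷ t)) (x j) (x (suc j)))
  (cong ((x j - x (suc j)) *_) (sym (trans (unfold x (j ∷ t)) (kill (x (suc j)) (square NQ [] j t)))))))
  where
  x′ = λ k → x (swap j k)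
  -- The factor S = A_j(x_j) A_j(x_{j+1}) A_{j+2}(x_{j+2}) ⋯, symmetric in x_j and x_{j+1} by
  -- `Ad-comm`.
  Q : (ℕ → ℤ) → Functional
  Q y = Sch r (suc (suc j)) y (Ad (suc (suc r)) j (y (suc j)) (Ad (suc (suc r)) j (y j) χ))
  NA : ∀ y → Nil (Ad (suc (suc r)) j (y (suc j)) (Ad (suc (suc r)) j (y j) χ))
  NA y = Ad-nil (suc (suc r)) j (y (suc j)) (Ad-nil (suc (suc r)) j (y j) N)
  NQ : Nil (Q x)
  NQ = Sch-nil r (suc (suc j)) x (NA x)
  neg : ∀ p q y → p + (- y) * q ≡ p - y * q
  neg = solve-∀
  ring : ∀ p q a b → (p - b * q) - (p - a * q) ≡ (a - b) * q
  ring = solve-∀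
  kill : ∀ {p q} b → q ≡ 0ℤ → p - b * q ≡ p
  kill {p} b refl = ring′ p b where
    ring′ : ∀ p b → p - b * 0ℤ ≡ p
    ring′ = solve-∀
  unfold : ∀ y s → Sch (suc (suc r)) j y χ s ≡ Q y s - y (suc j) * Q y (j ∷ s)
  unfold y s = trans (Sch-cong r (suc (suc j)) y (≐-sym (M-cancel j (y (suc j)) (Ad-nil (suc r) (suc j) (y (suc j)) (Ad-nil (suc (suc r)) j (y j) N)))) s)
    (trans (Sch-M-comm r y (- y (suc j)) (NA y) ℕ.≤-refl s) (neg (Q y s) (Q y (j ∷ s)) (y (suc j))))
  same : Q x ≐ Q x′
  same s = trans (Sch-cong r (suc (suc j)) x (Ad-comm (suc (suc r)) j (x j) (x (suc j)) N) s)
    (trans (Sch-cong-x r (suc (suc j)) _ (λ k h → cong x (sym (swap-> j h))) s)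
     (cong₂ (λ p q → Sch r (suc (suc j)) x′ (Ad (suc (suc r)) j p (Ad (suc (suc r)) j q χ)) s)
       (cong x (sym (swap-suc j))) (cong x (sym (swap-self j)))))
Sch-divided-difference (suc r) j (suc n) x {χ} N (ℕ.s≤s h) t
  with Sch-divided-difference r (suc j) n x (Ad-nil (suc r) j (x j) N) h t
... | ih rewrite ℕ.+-suc n j | swap-< (suc (n ℕ.+ j)) {j} (ℕ.s≤s (ℕ.m≤n+m j n)) = ih

-- Degree and leading coefficient

record Good (x : ℕ → ℤ) : Set where
  field
    injective : ∀ {j k} → x j ≡ x k → j ≡ k
    positive  : ∀ j → 0ℤ ℤ.< x j
open Good

Good-swap : ∀ i {x} → Good x → Good (λ k → x (swap i k))
injective (Good-swap i {x} G) {j} {k} e =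
  trans (sym (swap-involutive i j)) (trans (cong (swap i) (injective G e)) (swap-involutive i k))
positive (Good-swap i G) j = positive G (swap i j)

Fun : Set
Fun = (ℕ → ℤ) → ℤ

infix 4 _≈_
record _≈_ (f g : Fun) : Set where
  constructor pointwise
  field at : ∀ x → Good x → f x ≡ g x
open _≈_

≈-refl : ∀ {f} → f ≈ f
at ≈-refl x G = refl

≈-sym : ∀ {f g} → f ≈ g → g ≈ f
at (≈-sym e) x G = sym (at e x G)

≈-trans : ∀ {f g h} → f ≈ g → g ≈ h → f ≈ h
at (≈-trans e e′) x G = trans (at e x G) (at e′ x G)

𝟎 : Fun
𝟎 _ = 0ℤ

infixl 6 _⊕_
infixl 7 _⊗_
opaque
  _⊕_ _⊗_ : Fun → Fun → Fun
  (f ⊕ g) x = f x + g x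
  (f ⊗ g) x = f x * g x

-- A relation rather than an operator, since for an arbitrary function the difference need not be
-- divisible by x_k - x_{k+1}.
record Δ (k : ℕ) (f g : Fun) : Set where
  constructor quotient
  field at : ∀ x → Good x → f x - f (λ j → x (swap k j)) ≡ (x k - x (suc k)) * g x
open Δ renaming (at to Δ-at)

Δ-resp : ∀ {k f f′ g g′} → f ≈ f′ → g ≈ g′ → Δ k f g → Δ k f′ g′
Δ-at (Δ-resp {k} ef eg δ) x G =
  trans (cong₂ _-_ (sym (at ef x G)) (sym (at ef _ (Good-swap k G))))
        (trans (Δ-at δ x G) (cong ((x k - x (suc k)) *_) (at eg x G)))

Δ-unique : ∀ {k f g h} → Δ k f g → Δ k f h → g ≈ h
at (Δ-unique {k} {f} {g} {h} δ δ′) x G =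
  ℤ.*-cancelˡ-≡ (x k - x (suc k)) (g x) (h x) {{ℤ.≢-nonZero ne}} (trans (sym (Δ-at δ x G)) (Δ-at δ′ x G))
  where
  ne : x k - x (suc k) ≢ 0ℤ
  ne e = ℕ.1+n≢n (sym (injective G (ℤ.i-j≡0⇒i≡j (x k) (x (suc k)) e)))

Δ-zero : ∀ k → Δ k 𝟎 𝟎
Δ-at (Δ-zero k) x G = sym (ℤ.*-zeroʳ (x k - x (suc k)))

opaque
  unfolding _⊕_ _⊗_

  Δ-add : ∀ {k f f′ g g′} → Δ k f f′ → Δ k g g′ → Δ k (f ⊕ g) (f′ ⊕ g′)
  Δ-at (Δ-add {k} {f} {f′} {g} {g′} δ δ′) x G =
    trans (ring (f x) (g x) _ _) (trans (cong₂ _+_ (Δ-at δ x G) (Δ-at δ′ x G)) (sym (ℤ.*-distribˡ-+ (x k - x (suc k)) (f′ x) (g′ x))))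
    where
    ring : ∀ a b c d → (a + b) - (c + d) ≡ (a - c) + (b - d)
    ring = solve-∀

η : ℕ → Fun
η k x = x (suc k) - x k

opaque
  unfolding _⊕_ _⊗_

  -- f ⊕ f′ ⊗ η k is f with the variables k and k + 1 exchanged.
  Δ-mul : ∀ {k f f′ g g′} → Δ k f f′ → Δ k g g′ → Δ k (f ⊗ g) ((f′ ⊗ g) ⊕ ((f ⊕ (f′ ⊗ η k)) ⊗ g′))
  Δ-at (Δ-mul {k} {f} {f′} {g} {g′} δ δ′) x G =
    trans (leibniz (f x) (f _) (g x) (g _))
    (trans (cong₂ (λ a b → a * g x + b) (Δ-at δ x G) (cong₂ _*_ (shift (f x) (f _)) (Δ-at δ′ x G)))
    (trans (cong (λ a → (x k - x (suc k)) * f′ x * g x + (f x - a) * ((x k - x (suc k)) * g′ x)) (Δ-at δ x G))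
    (ring (x k) (x (suc k)) (f x) (f′ x) (g x) (g′ x))))
    where
    leibniz : ∀ a b c d → a * c - b * d ≡ (a - b) * c + b * (c - d)
    leibniz = solve-∀
    shift : ∀ a b → b ≡ a - (a - b)
    shift = solve-∀
    ring : ∀ y z a a′ b b′ →
      (y - z) * a′ * b + (a - (y - z) * a′) * ((y - z) * b′) ≡ (y - z) * (a′ * b + (a + a′ * (z - y)) * b′)
    ring = solve-∀

-- At good points this is symmetry in x_0, ..., x_k.
Invariant : ℕ → Fun → Set
Invariant k f = ∀ a → a ℕ.< k → Δ a f 𝟎

-- The coefficient in degree `b` of a function killed by every letter: only the empty word
-- contributes.
Top : ℕ → Fun → Fun
Top zero    f = f
Top (suc b) f = 𝟎

Top-resp : ∀ b {f g} → f ≈ g → Top b f ≈ Top b g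
Top-resp zero    e = e
Top-resp (suc b) e = ≈-refl

-- LC n e (1 + b) f c: with respect to the letters < e + b + n, f has degree ≤ b and leading coefficient
-- c (LC n e 0 f c means f = 0).  The truncation leaves no letters below 0, so the recursion has to stop
-- at e = 0, where f is required to be invariant: each divided difference costs one letter of invariance,
-- which is why the final level b + n drops together with b.
data LC (n : ℕ) : ℕ → ℕ → Fun → Fun → Set where
  vanish : ∀ {e f c} → f ≈ 𝟎 → c ≈ 𝟎 → LC n e 0 f c
  base   : ∀ {b f c} → Invariant (b ℕ.+ n) f → c ≈ Top b f → LC n 0 (suc b) f c
  -- `k` is the largest letter. An increasing word either avoids it or ends in it, and in the second
  -- case ∂_k acts first.
  step   : ∀ {e b f c g F F′} k → k ≡ e ℕ.+ b ℕ.+ n → Δ k f g →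
           LC n e (suc b) f F → LC n (suc e) b g F′ → c ≈ F ⊕ F′ → LC n (suc e) (suc b) f c

LC-resp : ∀ {n e P f f′ c c′} → f ≈ f′ → c ≈ c′ → LC n e P f c → LC n e P f′ c′
LC-resp ef ec (vanish z z′) = vanish (≈-trans (≈-sym ef) z) (≈-trans (≈-sym ec) z′)
LC-resp ef ec (base {b} i t) = base (λ a h → Δ-resp ef ≈-refl (i a h))
  (≈-trans (≈-sym ec) (≈-trans t (Top-resp b ef)))
LC-resp ef ec (step k eq δ l l′ t) =
  step k eq (Δ-resp ef ≈-refl δ) (LC-resp ef ≈-refl l) l′ (≈-trans (≈-sym ec) t)

LC-index : ∀ {n e P Q f c} → P ≡ Q → LC n e P f c → LC n e Q f c
LC-index refl l = l

opaque
  unfolding _⊕_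

  LC-zero : ∀ n e P → LC n e P 𝟎 𝟎
  LC-zero n e       zero    = vanish ≈-refl ≈-refl
  LC-zero n zero    (suc b) = base (λ a _ → Δ-zero a) (top b)
    where
    top : ∀ b → 𝟎 ≈ Top b 𝟎
    top zero    = ≈-refl
    top (suc b) = ≈-refl
  LC-zero n (suc e) (suc b) =
    step _ refl (Δ-zero _) (LC-zero n e (suc b)) (LC-zero n (suc e) b) ≈-refl

LC-≈zero : ∀ {n e P f c} → f ≈ 𝟎 → c ≈ 𝟎 → LC n e P f c
LC-≈zero z z′ = LC-resp (≈-sym z) (≈-sym z′) (LC-zero _ _ _)

opaque
  unfolding _⊕_ _⊗_

  LC-add : ∀ {n e P f g c d} → LC n e P f c → LC n e P g d → LC n e P (f ⊕ g) (c ⊕ d)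
  LC-add (vanish z w) (vanish z′ w′) =
    vanish (pointwise λ x G → cong₂ _+_ (at z x G) (at z′ x G)) (pointwise λ x G → cong₂ _+_ (at w x G) (at w′ x G))
  LC-add (base {b} i t) (base i′ t′) =
    base (λ a h → Δ-add (i a h) (i′ a h)) (pointwise λ x G → trans (cong₂ _+_ (at t x G) (at t′ x G)) (top b x))
    where
    top : ∀ b {f g} x → Top b f x + Top b g x ≡ Top b (f ⊕ g) x
    top zero    x = refl
    top (suc b) x = refl
  LC-add {c = c} {d} (step {F = F} {F′} k refl δ l m t) (step {F = E} {E′} k′ refl δ′ l′ m′ t′) =
    step k refl (Δ-add δ δ′) (LC-add l l′) (LC-add m m′)
      (pointwise λ x G → trans (cong₂ _+_ (at t x G) (at t′ x G)) (ring (F x) (F′ x) (E x) (E′ x)))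
    where
    ring : ∀ a b c d → (a + b) + (c + d) ≡ (a + c) + (b + d)
    ring = solve-∀

  LC-invariant : ∀ {n f} e b → Invariant (e ℕ.+ b ℕ.+ n) f → LC n e (suc b) f (Top b f)
  LC-invariant zero    b i = base i ≈-refl
  LC-invariant {n} {f} (suc e) b i =
    step _ refl (i _ ℕ.≤-refl) (LC-invariant e b (λ a h → i a (ℕ.m≤n⇒m≤1+n h)))
      (LC-zero n (suc e) b) (pointwise λ x _ → sym (ℤ.+-identityʳ (Top b f x)))

-- The letters stay the same, since e + b + suc n = suc e + b + n; the recursion merely descends one
-- level further before it relies on invariance. This realigns a factor that was not differentiated
-- with one that was.
LC-weaken : ∀ {n e P f c} → LC (suc n) e P f c → LC n (suc e) P f c
LC-weaken (vanish z w) = vanish z w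
LC-weaken {n} {e} (base {b} i t) = LC-resp ≈-refl (≈-sym t)
  (LC-invariant 1 b (λ a h → i a (subst (a ℕ.<_) (sym (ℕ.+-suc b n)) h)))
LC-weaken {n} (step {e} {b} k eq δ l m t) =
  step k (trans eq (ℕ.+-suc (e ℕ.+ b) n)) δ (LC-weaken l) (LC-weaken m) t

opaque
  unfolding _⊕_ _⊗_

  -- Divided differences are unique, so the recursion determines `c`. Two computations for the same
  -- function can therefore be compared.
  LC-unique : ∀ {n e P f f′ c c′} → f ≈ f′ → LC n e P f c → LC n e P f′ c′ → c ≈ c′
  LC-unique ef (vanish _ w) (vanish _ w′) = ≈-trans w (≈-sym w′)
  LC-unique ef (base {b} _ t) (base _ t′) = ≈-trans t (≈-trans (Top-resp b ef) (≈-sym t′))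
  at (LC-unique ef (step k refl δ l m t) (step _ refl δ′ l′ m′ t′)) x G =
    trans (at t x G) (trans (cong₂ _+_ (at (LC-unique ef l l′) x G)
      (at (LC-unique (Δ-unique (Δ-resp ef ≈-refl δ) δ′) m m′) x G)) (sym (at t′ x G)))

Δ-const : ∀ k z → Δ k (λ _ → z) 𝟎
Δ-at (Δ-const k z) x G = trans (ℤ.+-inverseʳ z) (sym (ℤ.*-zeroʳ (x k - x (suc k))))

η-invariant : ∀ {a k} → suc a ℕ.< k → Δ a (η k) 𝟎
Δ-at (η-invariant {a} {k} h) x G rewrite swap-> a h | swap-> a {suc k} (ℕ.m≤n⇒m≤1+n h) =
  trans (ℤ.+-inverseʳ (x (suc k) - x k)) (sym (ℤ.*-zeroʳ (x a - x (suc a))))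

η-suc : ∀ a → Δ a (η (suc a)) (λ _ → 1ℤ)
Δ-at (η-suc a) x G rewrite swap-suc a | swap-> a {suc (suc a)} ℕ.≤-refl = ring (x a) (x (suc a)) (x (suc (suc a)))
  where
  ring : ∀ a b c → (c - b) - (c - a) ≡ (a - b) * 1ℤ
  ring = solve-∀

opaque
  unfolding _⊕_ _⊗_

  -- The letters in play are those below `k`; only k - 1 moves η_k, and ∂_{k-1} η_k = 1.
  LC-η : ∀ {n e k} → k ≡ suc (e ℕ.+ 1 ℕ.+ n) → LC n (suc e) 2 (η k) (λ _ → 1ℤ)
  LC-η {n} {e} refl = step _ refl (η-suc _)
    (LC-invariant e 1 (λ a h → η-invariant (s≤s h)))
    (LC-invariant (suc e) 0 (λ a h → Δ-const a 1ℤ)) ≈-refl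

  LC-zeroˡ : ∀ {n e P f g c d} → f ≈ 𝟎 → c ≈ 𝟎 → LC n e P (f ⊗ g) (c ⊗ d)
  LC-zeroˡ {g = g} {d = d} z w =
    LC-≈zero (pointwise λ x G → trans (cong (_* g x) (at z x G)) (ℤ.*-zeroˡ (g x)))
             (pointwise λ x G → trans (cong (_* d x) (at w x G)) (ℤ.*-zeroˡ (d x)))

  LC-zeroʳ : ∀ {n e P f g c d} → g ≈ 𝟎 → d ≈ 𝟎 → LC n e P (f ⊗ g) (c ⊗ d)
  LC-zeroʳ {f = f} {c = c} z w =
    LC-≈zero (pointwise λ x G → trans (cong (f x *_) (at z x G)) (ℤ.*-zeroʳ (f x)))
             (pointwise λ x G → trans (cong (c x *_) (at w x G)) (ℤ.*-zeroʳ (c x)))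

  LC-mul-base : ∀ n p q {f g c d} → LC (q ℕ.+ n) 0 (suc p) f c → LC (p ℕ.+ n) 0 (suc q) g d →
    LC n 0 (suc (p ℕ.+ q)) (f ⊗ g) (c ⊗ d)
  LC-mul-base n p q {f} {g} (base i t) (base i′ t′) =
    base product-invariant (pointwise λ x G → trans (cong₂ _*_ (at t x G) (at t′ x G)) (top p q x))
    where
    assoc′ : p ℕ.+ q ℕ.+ n ≡ q ℕ.+ (p ℕ.+ n)
    assoc′ = trans (cong (ℕ._+ n) (ℕ.+-comm p q)) (ℕ.+-assoc q p n)
    product-invariant : Invariant (p ℕ.+ q ℕ.+ n) (f ⊗ g)
    product-invariant a h = Δ-resp ≈-refl (pointwise λ x G → cong₂ _+_ (ℤ.*-zeroˡ (g x)) (ℤ.*-zeroʳ (f x + 0ℤ * η a x)))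
      (Δ-mul (i a (subst (a ℕ.<_) (ℕ.+-assoc p q n) h)) (i′ a (subst (a ℕ.<_) assoc′ h)))
    top : ∀ p q x → Top p f x * Top q g x ≡ Top (p ℕ.+ q) (f ⊗ g) x
    top zero    zero    x = refl
    top zero    (suc q) x = ℤ.*-zeroʳ (f x)
    top (suc p) q       x = ℤ.*-zeroˡ (Top q g x)

  -- The Leibniz rule on leading coefficients: words avoiding k give F E, words ending in k give F′
  -- E + (F + F′) E′, together (F + F′)(E + E′). The factor 1 is the leading coefficient of η_k.
  LC-mul-step : ∀ {n e} p q {f g c d f′ g′ F F′ E E′ k k′} →
    k ≡ e ℕ.+ p ℕ.+ (q ℕ.+ n) → k′ ≡ e ℕ.+ q ℕ.+ (p ℕ.+ n) → Δ k f f′ → Δ k′ g g′ →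
    c ≈ F ⊕ F′ → d ≈ E ⊕ E′ →
    LC n e (suc (p ℕ.+ q)) (f ⊗ g) (F ⊗ E) →
    LC n (suc e) (p ℕ.+ q) (f′ ⊗ g) (F′ ⊗ E) →
    LC n (suc e) (p ℕ.+ q) ((f ⊕ (f′ ⊗ η k)) ⊗ g′) ((F ⊕ (F′ ⊗ (λ _ → 1ℤ))) ⊗ E′) →
    LC n (suc e) (suc (p ℕ.+ q)) (f ⊗ g) (c ⊗ d)
  LC-mul-step {n} {e} p q {f} {g} {F = F} {F′} {E} {E′} {k} {k′} eq eq′ δ δ′ t t′ l m m′ =
    step k (trans eq (index e p q n)) (Δ-mul δ (subst (λ z → Δ z g _) k′≡k δ′)) l (LC-add m m′)
      (pointwise λ x G → trans (cong₂ _*_ (at t x G) (at t′ x G)) (ring (F x) (F′ x) (E x) (E′ x)))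
    where
    index : ∀ e p q n → e ℕ.+ p ℕ.+ (q ℕ.+ n) ≡ e ℕ.+ (p ℕ.+ q) ℕ.+ n
    index = ℕ-Ring.solve-∀
    index′ : ∀ e p q n → e ℕ.+ q ℕ.+ (p ℕ.+ n) ≡ e ℕ.+ p ℕ.+ (q ℕ.+ n)
    index′ = ℕ-Ring.solve-∀
    k′≡k : k′ ≡ k
    k′≡k = trans eq′ (trans (index′ e p q n) (sym eq))
    ring : ∀ F F′ E E′ → (F + F′) * (E + E′) ≡ F * E + (F′ * E + (F + F′ * 1ℤ) * E′)
    ring = solve-∀

-- Each factor carries the degree of the other as extra margin, so both have the same letters as the
-- product. When ∂_k lowers one degree, `LC-weaken` adjusts the factor left untouched.
LC-mul : ∀ n e p q {f g c d} → LC (q ℕ.+ n) e (suc p) f c → LC (p ℕ.+ n) e (suc q) g d →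
  LC n e (suc (p ℕ.+ q)) (f ⊗ g) (c ⊗ d)
LC-mul n zero p q l l′ = LC-mul-base n p q l l′
LC-mul n (suc e) zero zero (step k eq δ l (vanish z w) t) (step k′ eq′ δ′ l′ (vanish z′ w′) t′) =
  LC-mul-step zero zero eq eq′ δ δ′ t t′ (LC-mul n e zero zero l l′) (LC-zeroˡ z w) (LC-zeroʳ z′ w′)
LC-mul n (suc e) (suc p) zero (step k eq δ l m t) (step k′ eq′ δ′ l′ (vanish z′ w′) t′) =
  LC-mul-step (suc p) zero eq eq′ δ δ′ t t′ (LC-mul n e (suc p) zero l l′)
    (LC-mul n (suc e) p zero m (LC-weaken l′)) (LC-zeroʳ z′ w′)
LC-mul n (suc e) zero (suc q) (step k eq δ l (vanish z w) t) (step k′ eq′ δ′ l′ m′ t′) =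
  LC-mul-step zero (suc q) eq eq′ δ δ′ t t′ (LC-mul n e zero (suc q) l l′) (LC-zeroˡ z w)
    (LC-mul n (suc e) zero q (LC-add (LC-weaken l) (LC-zeroˡ z w)) m′)
LC-mul n (suc e) (suc p) (suc q) (step k eq δ l m t) (step k′ eq′ δ′ l′ m′ t′) =
  LC-mul-step (suc p) (suc q) eq eq′ δ δ′ t t′ (LC-mul n e (suc p) (suc q) l l′)
    (LC-mul n (suc e) p (suc q) m (LC-weaken l′))
    (LC-index (sym (ℕ.+-suc (suc p) q))
      (LC-mul n (suc e) (suc p) q
        -- s_k f = f + f′ η_k has the degree of f again: η_k restores the degree that f′ has lost.
        (LC-add (LC-weaken l)
          (LC-index (cong suc (ℕ.+-comm p 1))
            (LC-mul (q ℕ.+ n) (suc e) p 1 m (LC-η (trans eq (index e p q n))))))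
        m′))
  where
  index : ∀ e p q n → e ℕ.+ suc p ℕ.+ (suc q ℕ.+ n) ≡ suc (e ℕ.+ 1 ℕ.+ (p ℕ.+ (q ℕ.+ n)))
  index = ℕ-Ring.solve-∀

-- Schubert polynomials and their leading coefficients

-- Apart from the term choosing 1 in every factor, each term of the expansion puts letters in front
-- of `w`, where χ vanishes.
Sch-top : ∀ r j x {χ} w → (∀ a s → χ (a ∷ s ++ w) ≡ 0ℤ) → Sch r j x χ w ≡ χ w
Sch-top r j x w = go r j x
  where
  Z : Functional → Set
  Z χ = ∀ a s → χ (a ∷ s ++ w) ≡ 0ℤ
  zeros : ∀ {p q} x → p ≡ 0ℤ → q ≡ 0ℤ → p + x * q ≡ 0ℤ
  zeros x refl refl = trans (ℤ.+-identityˡ _) (ℤ.*-zeroʳ x)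
  Ad-Z : ∀ r j x χ → Z χ → Z (Ad r j x χ)
  Ad-Z zero    j x χ z = z
  Ad-Z (suc r) j x χ z a s = zeros x (Ad-Z r (suc j) x χ z a s) (Ad-Z r (suc j) x χ z j (a ∷ s))
  Ad-top : ∀ r j x χ → Z χ → Ad r j x χ w ≡ χ w
  Ad-top zero    j x χ z = refl
  Ad-top (suc r) j x χ z =
    trans (cong (λ q → Ad r (suc j) x χ w + x * q) (Ad-Z r (suc j) x χ z j []))
    (trans (cong (Ad r (suc j) x χ w +_) (ℤ.*-zeroʳ x)) (trans (ℤ.+-identityʳ _) (Ad-top r (suc j) x χ z)))
  go : ∀ r j x {χ} → Z χ → Sch r j x χ w ≡ χ w
  go zero    j x z = refl
  go (suc r) j x z = trans (go r (suc j) x (Ad-Z (suc r) j (x j) _ z)) (Ad-top (suc r) j (x j) _ z)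

Nonnegative : Functional → Set
Nonnegative χ = ∀ t → 0ℤ ℤ.≤ χ t

*-nonneg : ∀ {x y} → 0ℤ ℤ.≤ x → 0ℤ ℤ.≤ y → 0ℤ ℤ.≤ x * y
*-nonneg {x} {y} p q = subst (ℤ._≤ x * y) (ℤ.*-zeroʳ x) (ℤ.*-monoˡ-≤-nonNeg x {{ℤ.nonNegative p}} q)

*-pos : ∀ {x y} → 0ℤ ℤ.< x → 0ℤ ℤ.< y → 0ℤ ℤ.< x * y
*-pos {x} {y} p q = subst (ℤ._< x * y) (ℤ.*-zeroʳ x) (ℤ.*-monoˡ-<-pos x {{ℤ.positive p}} q)

Ad-nonneg : ∀ r j {x χ} → 0ℤ ℤ.≤ x → Nonnegative χ → Nonnegative (Ad r j x χ)
Ad-nonneg zero    j p c   = c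
Ad-nonneg (suc r) j p c t =
  ℤ.+-mono-≤ (Ad-nonneg r (suc j) p c t) (*-nonneg p (Ad-nonneg r (suc j) p c (j ∷ t)))

Ad-skip : ∀ r j {x χ} t → 0ℤ ℤ.≤ x → Nonnegative χ → 0ℤ ℤ.< χ t → 0ℤ ℤ.< Ad r j x χ t
Ad-skip zero    j t p c q = q
Ad-skip (suc r) j t p c q =
  ℤ.+-mono-<-≤ (Ad-skip r (suc j) t p c q) (*-nonneg p (Ad-nonneg r (suc j) p c (j ∷ t)))

-- Choose x u_a from the factor of the letter a and 1 from the others; the remaining terms are
-- nonnegative.
Ad-take : ∀ r j {x χ a} t → 0ℤ ℤ.< x → Nonnegative χ → j ℕ.≤ a → a ℕ.< j ℕ.+ r →
  0ℤ ℤ.< χ (a ∷ t) → 0ℤ ℤ.< Ad r j x χ t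
Ad-take zero    j t p c h h′ q = ⊥-elim (ℕ.<⇒≱ h′ (subst (ℕ._≤ _) (sym (ℕ.+-identityʳ j)) h))
Ad-take (suc r) j {a = a} t p c h h′ q with j ℕ.≟ a
... | yes refl = ℤ.+-mono-≤-< (Ad-nonneg r (suc j) (ℤ.<⇒≤ p) c t)
                   (*-pos p (Ad-skip r (suc j) (j ∷ t) (ℤ.<⇒≤ p) c q))
... | no j≢a = ℤ.+-mono-<-≤
                 (Ad-take r (suc j) t p c (ℕ.≤∧≢⇒< h j≢a) (subst (a ℕ.<_) (ℕ.+-suc j r) h′) q)
                 (*-nonneg (ℤ.<⇒≤ p) (Ad-nonneg r (suc j) (ℤ.<⇒≤ p) c (j ∷ t)))

Sch-nonneg : ∀ r j {x χ} → (∀ k → 0ℤ ℤ.< x k) → Nonnegative χ → Nonnegative (Sch r j x χ)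
Sch-nonneg zero    j p c = c
Sch-nonneg (suc r) j p c = Sch-nonneg r (suc j) p (Ad-nonneg (suc r) j (ℤ.<⇒≤ (p j)) c)

-- Take the letters of `s` one by one from A_j, A_{j+1}, .... Each factor still contains the letter
-- wanted, because all letters are at least j + length s.
Sch-pos : ∀ r j {x χ} s w → (∀ k → 0ℤ ℤ.< x k) → Nonnegative χ →
  All (λ a → j ℕ.+ length s ℕ.≤ a × a ℕ.< j ℕ.+ r) s → 0ℤ ℤ.< χ (s ++ w) → 0ℤ ℤ.< Sch r j x χ w
Sch-pos zero    j []      w p c h q = q
Sch-pos zero    j (a ∷ s) w p c ((h , h′) ∷ _) q =
  ⊥-elim (ℕ.<⇒≱ h′ (ℕ.≤-trans (ℕ.+-monoʳ-≤ j z≤n) h))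
Sch-pos (suc r) j []      w p c h q =
  Sch-pos r (suc j) [] w p (Ad-nonneg (suc r) j (ℤ.<⇒≤ (p j)) c) [] (Ad-skip (suc r) j w (ℤ.<⇒≤ (p j)) c q)
Sch-pos (suc r) j (a ∷ s) w p c ((h , h′) ∷ hs) q =
  Sch-pos r (suc j) s w p (Ad-nonneg (suc r) j (ℤ.<⇒≤ (p j)) c)
    (All.map (λ {b} (g , g′) → subst (ℕ._≤ b) (ℕ.+-suc j (length s)) g , subst (b ℕ.<_) (ℕ.+-suc j r) g′) hs)
    (Ad-take (suc r) j (s ++ w) (p j) c (ℕ.≤-trans (ℕ.m≤m+n j _) h) h′ q)

-- An increasing suffix read from its last letter; `d ʳ++ w` restores its order in front of `w`.
data Decreasing : ℕ → List ℕ → Set where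
  []  : ∀ {k} → Decreasing k []
  _∷_ : ∀ {k a d} → a ℕ.< k → Decreasing a d → Decreasing k (a ∷ d)

Decreasing-mono : ∀ {k l d} → k ℕ.≤ l → Decreasing k d → Decreasing l d
Decreasing-mono h []      = []
Decreasing-mono h (p ∷ D) = ℕ.<-≤-trans p h ∷ D

module _ (K : ℕ) where

  ⟦_⟧ : Functional → List ℕ → Fun
  ⟦ χ ⟧ w x = Sch K 0 x χ w

  module _ {χ : Functional} (N : Nil χ) where

    ⟦⟧-Δ : ∀ a w → suc a ℕ.< K → Δ a (⟦ χ ⟧ w) (⟦ χ ⟧ (a ∷ w))
    Δ-at (⟦⟧-Δ a w h) x G with Sch-divided-difference K 0 a x N h w
    ... | e rewrite ℕ.+-identityʳ a = e

    ⟦⟧-∷-zero : ∀ a w → suc a ℕ.< K → ⟦ χ ⟧ w ≈ 𝟎 → ⟦ χ ⟧ (a ∷ w) ≈ 𝟎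
    ⟦⟧-∷-zero a w h z = Δ-unique (⟦⟧-Δ a w h) (Δ-resp (≈-sym z) ≈-refl (Δ-zero a))

    ⟦⟧-ʳ++-zero : ∀ d w → All (λ a → suc a ℕ.< K) d → ⟦ χ ⟧ w ≈ 𝟎 → ⟦ χ ⟧ (d ʳ++ w) ≈ 𝟎
    ⟦⟧-ʳ++-zero []      w []      z = z
    ⟦⟧-ʳ++-zero (a ∷ d) w (h ∷ H) z = ⟦⟧-ʳ++-zero d (a ∷ w) H (⟦⟧-∷-zero a w h z)

    Decreasing-All : ∀ {k d} → k ℕ.< K → Decreasing k d → All (λ a → suc a ℕ.< K) d
    Decreasing-All h []      = []
    Decreasing-All h (p ∷ D) = ℕ.≤-<-trans p h ∷ Decreasing-All (ℕ.<-trans p h) D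

    -- Follow the recursion of `LC`: if the suffix ends in the largest letter, enter the branch of
    -- its divided difference, otherwise discard that letter. At the base a single letter kills by
    -- invariance.
    LC-kills : ∀ {n e P k d f c} w → LC n e P f c → f ≈ ⟦ χ ⟧ w → suc k ≡ e ℕ.+ P ℕ.+ n → k ℕ.< K →
      Decreasing k d → P ℕ.≤ length d → ⟦ χ ⟧ (d ʳ++ w) ≈ 𝟎
    LC-kills w (vanish z _) f≈ eq h D len = ⟦⟧-ʳ++-zero _ w (Decreasing-All h D) (≈-trans (≈-sym f≈) z)
    LC-kills w (base inv t) f≈ refl h (p ∷ D) len =
      ⟦⟧-ʳ++-zero _ _ (Decreasing-All (ℕ.<-trans p h) D)
        (Δ-unique (⟦⟧-Δ _ w (ℕ.≤-<-trans p h)) (Δ-resp f≈ ≈-refl (inv _ p)))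
    LC-kills {n} {d = a ∷ d} w (step {e} {b} k₀ refl δ l m t) f≈ eq h (p ∷ D) (s≤s len)
      with trans (ℕ.suc-injective eq) (cong (ℕ._+ n) (ℕ.+-suc e b))
    ... | refl with a ℕ.≟ e ℕ.+ b ℕ.+ n
    ...   | no a≢k = LC-kills w l f≈ (cong (ℕ._+ n) (sym (ℕ.+-suc e b))) (ℕ.<-trans (ℕ.n<1+n _) h)
                       (ℕ.≤∧≢⇒< (ℕ.≤-pred p) a≢k ∷ D) (s≤s len)
    ...   | yes refl = LC-kills (a ∷ w) m (Δ-unique (Δ-resp f≈ ≈-refl δ) (⟦⟧-Δ a w h)) refl
                         (ℕ.<-trans (ℕ.n<1+n _) h) D len

    Low : ℕ → Set
    Low l = ∀ p {a} q → a ℕ.< l → χ (p ++ a ∷ q) ≡ 0ℤ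

    -- The sum of `⟦ χ ⟧ (d ʳ++ w)` over decreasing `d` of length P - 1, along the recursion of
    -- `LC`. At e = 0 nonempty `d` are dropped: under the bound P + n ≤ suc l their letters lie
    -- below `l`, where `Low` makes the terms vanish.
    leading : ℕ → ℕ → ℕ → List ℕ → Fun
    leading n e       zero    w = 𝟎
    leading n zero    (suc b) w = Top b (⟦ χ ⟧ w)
    leading n (suc e) (suc b) w = leading n e (suc b) w ⊕ leading n (suc e) b (e ℕ.+ b ℕ.+ n ∷ w)

    ⟦⟧-zero : ∀ w → (∀ s → χ (s ++ w) ≡ 0ℤ) → ⟦ χ ⟧ w ≈ 𝟎
    at (⟦⟧-zero w z) x G = trans (Sch-top K 0 x w (λ a s → z (a ∷ s))) (z [])

    Low-invariant : ∀ {l} w → l ℕ.< K → Low l → Invariant l (⟦ χ ⟧ w)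
    Low-invariant w h low a p =
      Δ-resp ≈-refl (⟦⟧-zero (a ∷ w) (λ s → low s w p)) (⟦⟧-Δ a w (ℕ.≤-<-trans p h))

    -- The base case consumes P + n ≤ suc l: the letters left there are below `l`, so `Low` gives
    -- invariance. The last hypothesis expresses the degree bound on the level of words.
    LC-leading : ∀ {l} n e P {k} w → l ℕ.< K → Low l → P ℕ.+ n ℕ.≤ suc l → suc k ≡ e ℕ.+ P ℕ.+ n → k ℕ.< K →
      (∀ d → Decreasing k d → P ℕ.≤ length d → ∀ s → χ (s ++ (d ʳ++ w)) ≡ 0ℤ) →
      LC n e P (⟦ χ ⟧ w) (leading n e P w)
    LC-leading n e zero w l<K low b eq h v = vanish (⟦⟧-zero w (v [] [] z≤n)) ≈-refl
    LC-leading n zero (suc b) w l<K low (s≤s p) eq h v =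
      base (λ a q → Low-invariant w l<K low a (ℕ.<-≤-trans q p)) ≈-refl
    LC-leading n (suc e) (suc b) w l<K low p eq h v with trans (ℕ.suc-injective eq) (cong (ℕ._+ n) (ℕ.+-suc e b))
    ... | refl = step _ refl (⟦⟧-Δ _ w h)
      (LC-leading n e (suc b) w l<K low p (cong (ℕ._+ n) (sym (ℕ.+-suc e b))) (ℕ.<-trans (ℕ.n<1+n _) h)
        (λ d D → v d (Decreasing-mono (ℕ.n≤1+n _) D)))
      (LC-leading n (suc e) b (_ ∷ w) l<K low (ℕ.≤-trans (ℕ.n≤1+n _) p) refl (ℕ.<-trans (ℕ.n<1+n _) h)
        (λ d D len → v (_ ∷ d) (ℕ.n<1+n _ ∷ D) (s≤s len)))
      ≈-refl

    -- The vanishing on words starts one length earlier than in `LC-leading`, so it reaches the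
    -- words that make up the leading coefficient itself.
    leading-zero : ∀ n e b {k} w → suc k ≡ e ℕ.+ suc b ℕ.+ n →
      (∀ d → Decreasing k d → b ℕ.≤ length d → ∀ s → χ (s ++ (d ʳ++ w)) ≡ 0ℤ) → leading n e (suc b) w ≈ 𝟎
    leading-zero n zero zero w eq v = ⟦⟧-zero w (v [] [] z≤n)
    leading-zero n zero (suc b) w eq v = ≈-refl
    leading-zero n (suc e) b w eq v with trans (ℕ.suc-injective eq) (cong (ℕ._+ n) (ℕ.+-suc e b))
    ... | refl = ⊕-zero
        (leading-zero n e b w (cong (ℕ._+ n) (sym (ℕ.+-suc e b))) (λ d D → v d (Decreasing-mono (ℕ.n≤1+n _) D)))
        (rest b v)
      where
      opaque
        unfolding _⊕_
        ⊕-zero : ∀ {f g} → f ≈ 𝟎 → g ≈ 𝟎 → f ⊕ g ≈ 𝟎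
        at (⊕-zero z z′) x G = cong₂ _+_ (at z x G) (at z′ x G)
      rest : ∀ b → (∀ d → Decreasing (suc (e ℕ.+ b ℕ.+ n)) d → b ℕ.≤ length d → ∀ s → χ (s ++ (d ʳ++ w)) ≡ 0ℤ) →
        leading n (suc e) b (e ℕ.+ b ℕ.+ n ∷ w) ≈ 𝟎
      rest zero    v = ≈-refl
      rest (suc b) v = leading-zero n (suc e) b _ refl (λ d D len → v (_ ∷ d) (ℕ.n<1+n _ ∷ D) (s≤s len))

    module _ (nonneg : Nonnegative χ) where

      opaque
        unfolding _⊕_

        leading-nonneg : ∀ n e P w {x} → Good x → 0ℤ ℤ.≤ leading n e P w x
        leading-nonneg n e       zero          w G = ℤ.≤-refl
        leading-nonneg n zero    (suc zero)    w G = Sch-nonneg K 0 (positive G) nonneg w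
        leading-nonneg n zero    (suc (suc b)) w G = ℤ.≤-refl
        leading-nonneg n (suc e) (suc b)       w G =
          ℤ.+-mono-≤ (leading-nonneg n e (suc b) w G) (leading-nonneg n (suc e) b _ G)

        -- All summands are nonnegative and the one belonging to `d` is positive by `Sch-pos`;
        -- comparing the head of `d` with the largest letter locates it.
        leading-pos : ∀ {l} n e P {k} w d s {x} → Good x → Low l → P ℕ.+ n ℕ.≤ suc l →
          suc k ≡ e ℕ.+ P ℕ.+ n → Decreasing k d → P ≡ suc (length d) →
          All (λ a → length s ℕ.≤ a × a ℕ.< K) s → 0ℤ ℤ.< χ (s ++ (d ʳ++ w)) → 0ℤ ℤ.< leading n e P w x
        leading-pos n zero _ w [] s G low h eq D refl bd q = Sch-pos K 0 s w (positive G) nonneg bd q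
        -- At e = 0 every remaining letter is below `l`, so a nonempty `d` contradicts `Low`.
        leading-pos n zero _ w (a ∷ d) s G low (s≤s h) refl (p ∷ D) refl bd q =
          ⊥-elim (ℤ.<⇒≢ q (sym (trans (cong χ (trans (cong (s ++_) (ʳ++-defn d)) (sym (++-assoc s (reverse d) (a ∷ w)))))
            (low (s ++ reverse d) w (ℕ.<-≤-trans p h)))))
        leading-pos n (suc e) (suc b) w [] s G low h eq D refl bd q =
          ℤ.+-mono-<-≤
            (leading-pos n e 1 w [] s G low h (sym (cong (ℕ._+ n) (ℕ.+-comm e 1))) [] refl bd q)
            (leading-nonneg n (suc e) 0 (e ℕ.+ 0 ℕ.+ n ∷ w) G)
        leading-pos {l} n (suc e) (suc b) {k} w (a ∷ d) s {x} G low h eq (p ∷ D) refl bd q =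
          [ (λ a<k → ℤ.+-mono-<-≤
              (leading-pos n e (suc b) w (a ∷ d) s G low h k≡ (a<k ∷ D) refl bd q)
              (leading-nonneg n (suc e) b _ G))
          , (λ a≡k → ℤ.+-mono-≤-< (leading-nonneg n e (suc b) w G)
              (leading-pos n (suc e) b _ d s G low (ℕ.≤-trans (ℕ.n≤1+n _) h) refl
                (subst (λ z → Decreasing z d) a≡k D) refl bd (subst (λ z → 0ℤ ℤ.< χ (s ++ (d ʳ++ z ∷ w))) a≡k q)))
          ]′ (ℕ.m≤n⇒m<n∨m≡n (ℕ.≤-pred (subst (a ℕ.<_) (trans (ℕ.suc-injective eq) (sym k≡)) p)))
          where
          k≡ : suc (e ℕ.+ b ℕ.+ n) ≡ e ℕ.+ suc b ℕ.+ n
          k≡ = cong (ℕ._+ n) (sym (ℕ.+-suc e b))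

-- Summation over monomials

∑ : ℕ → (ℕ → ℤ) → ℤ
∑ zero    f = f 0
∑ (suc n) f = f 0 + ∑ n (f ∘ suc)

∑-cong : ∀ n {f g} → (∀ k → k ℕ.≤ n → f k ≡ g k) → ∑ n f ≡ ∑ n g
∑-cong zero    e = e 0 z≤n
∑-cong (suc n) e = cong₂ _+_ (e 0 z≤n) (∑-cong n (λ k h → e (suc k) (s≤s h)))

∑-zero : ∀ n {f} → (∀ k → f k ≡ 0ℤ) → ∑ n f ≡ 0ℤ
∑-zero zero    e = e 0
∑-zero (suc n) e = cong₂ _+_ (e 0) (∑-zero n (e ∘ suc))

∑-linear : ∀ n f c g → ∑ n (λ k → f k + c * g k) ≡ ∑ n f + c * ∑ n g
∑-linear zero    f c g = refl
∑-linear (suc n) f c g = trans (cong ((f 0 + c * g 0) +_) (∑-linear n (f ∘ suc) c (g ∘ suc)))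
  (ring (f 0) (g 0) (∑ n (f ∘ suc)) (∑ n (g ∘ suc)) c)
  where
  ring : ∀ f₀ g₀ f g c → (f₀ + c * g₀) + (f + c * g) ≡ (f₀ + f) + c * (g₀ + g)
  ring = solve-∀

∑-scale : ∀ n c f → ∑ n (λ k → c * f k) ≡ c * ∑ n f
∑-scale zero    c f = refl
∑-scale (suc n) c f = trans (cong (c * f 0 +_) (∑-scale n c (f ∘ suc))) (sym (ℤ.*-distribˡ-+ c (f 0) _))

Ad-linear : ∀ r j x φ c ψ → Ad r j x (λ t → φ t + c * ψ t) ≐ (λ t → Ad r j x φ t + c * Ad r j x ψ t)
Ad-linear zero    j x φ c ψ t = refl
Ad-linear (suc r) j x φ c ψ t =
  trans (cong₂ (λ p q → p + x * q) (Ad-linear r (suc j) x φ c ψ t) (Ad-linear r (suc j) x φ c ψ (j ∷ t)))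
    (ring (Ad r (suc j) x φ t) (Ad r (suc j) x ψ t) (Ad r (suc j) x φ (j ∷ t)) (Ad r (suc j) x ψ (j ∷ t)) x c)
  where
  ring : ∀ p q p′ q′ x c → (p + c * q) + x * (p′ + c * q′) ≡ (p + x * p′) + c * (q + x * q′)
  ring = solve-∀

Sch-linear : ∀ r j x φ c ψ → Sch r j x (λ t → φ t + c * ψ t) ≐ (λ t → Sch r j x φ t + c * Sch r j x ψ t)
Sch-linear zero    j x φ c ψ t = refl
Sch-linear (suc r) j x φ c ψ =
  Sch-cong r (suc j) x (Ad-linear (suc r) j (x j) φ c ψ)
  ⟫ Sch-linear r (suc j) x (Ad (suc r) j (x j) φ) c (Ad (suc r) j (x j) ψ)

Sch-zero : ∀ r j x → Sch r j x (λ _ → 0ℤ) ≐ (λ _ → 0ℤ)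
Sch-zero zero    j x t = refl
Sch-zero (suc r) j x = Sch-cong r (suc j) x (Ad-zero (suc r) j) ⟫ Sch-zero r (suc j) x
  where
  Ad-zero : ∀ r j {x} → Ad r j x (λ _ → 0ℤ) ≐ (λ _ → 0ℤ)
  Ad-zero zero    j t = refl
  Ad-zero (suc r) j {x} t = trans (cong₂ (λ p q → p + x * q) (Ad-zero r (suc j) t) (Ad-zero r (suc j) (j ∷ t))) (trans (ℤ.+-identityˡ _) (ℤ.*-zeroʳ x))

-- Functionals of single words

δ : List ℕ → Functional
δ []      []      = 1ℤ
δ []      (_ ∷ _) = 0ℤ
δ (_ ∷ _) []      = 0ℤ
δ (a ∷ t) (b ∷ s) = if a ℕ.≡ᵇ b then δ t s else 0ℤ

δ-head-≢ : ∀ {a b} t s → a ≢ b → δ (a ∷ t) (b ∷ s) ≡ 0ℤ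
δ-head-≢ {a} {b} t s h with a ℕ.≡ᵇ b in eq
... | true  = ⊥-elim (h (ℕ.≡ᵇ⇒≡ a b (Equivalence.from T-≡ eq)))
... | false = refl

δ-head-≡ : ∀ a t s → δ (a ∷ t) (a ∷ s) ≡ δ t s
δ-head-≡ a t s rewrite Equivalence.to T-≡ (ℕ.≡⇒≡ᵇ a a refl) = refl

M-fix : ∀ a x {χ} → (∀ s → χ (a ∷ s) ≡ 0ℤ) → M a x χ ≐ χ
M-fix a x {χ} z s = trans (cong (λ q → χ s + x * q) (z s)) (trans (cong (χ s +_) (ℤ.*-zeroʳ x)) (ℤ.+-identityʳ (χ s)))

Ad-δ-[] : ∀ r j x → Ad r j x (δ []) ≐ δ []
Ad-δ-[] zero    j x s = refl
Ad-δ-[] (suc r) j x = M-cong j x (Ad-δ-[] r (suc j) x) ⟫ M-fix j x (λ s → refl)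

Ad-δ-below : ∀ r j x {a} t → a ℕ.< j → Ad r j x (δ (a ∷ t)) ≐ δ (a ∷ t)
Ad-δ-below zero    j x t h s = refl
Ad-δ-below (suc r) j x t h =
  M-cong j x (Ad-δ-below r (suc j) x t (ℕ.m≤n⇒m≤1+n h)) ⟫ M-fix j x (λ s → δ-head-≢ t s (ℕ.<⇒≢ h))

Ad-δ-above : ∀ r j x {a} t → r ℕ.+ j ℕ.≤ a → Ad r j x (δ (a ∷ t)) ≐ δ (a ∷ t)
Ad-δ-above zero    j x t h s = refl
Ad-δ-above (suc r) j x {a} t h =
  M-cong j x (Ad-δ-above r (suc j) x t (subst (ℕ._≤ a) (sym (ℕ.+-suc r j)) h))
  ⟫ M-fix j x (λ s → δ-head-≢ t s (λ e → ℕ.<⇒≢ (ℕ.≤-trans (s≤s (ℕ.m≤n+m j r)) h) (sym e)))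

-- The letters in A_j(x) decrease from left to right, so after i + j has been taken only the factors
-- of the `i` letters j, ..., i + j - 1 remain for the rest of the word.
Ad-δ-in : ∀ r j x i t → i ℕ.< r → Ad r j x (δ (i ℕ.+ j ∷ t)) ≐ (λ s → δ (i ℕ.+ j ∷ t) s + x * Ad i j x (δ t) s)
Ad-δ-in (suc r) j x zero t h =
  M-cong j x (Ad-δ-below r (suc j) x t ℕ.≤-refl) ⟫ (λ s → cong (λ q → δ (j ∷ t) s + x * q) (δ-head-≡ j t s))
Ad-δ-in (suc r) j x (suc i) t (s≤s h) s rewrite sym (ℕ.+-suc i j) =
  trans (M-cong j x (Ad-δ-in r (suc j) x i t h) s)
  (trans (cong (λ q → (δ (a ∷ t) s + x * Ad i (suc j) x (δ t) s) + x * (q + x * Ad i (suc j) x (δ t) (j ∷ s)))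
            (δ-head-≢ t s (λ e → ℕ.<⇒≢ (ℕ.m≤n+m (suc j) i) (sym e))))
  (ring (δ (a ∷ t) s) x (Ad i (suc j) x (δ t) s) (Ad i (suc j) x (δ t) (j ∷ s))))
  where
  a = i ℕ.+ suc j
  ring : ∀ d x p q → (d + x * p) + x * (0ℤ + x * q) ≡ d + x * (p + x * q)
  ring = solve-∀

-- Bottom rows of a word

i<i+1 : ∀ i → i ℤ.< i + 1ℤ
i<i+1 i = subst (i ℤ.<_) (ℤ.+-comm 1ℤ i) (ℤ.suc[i]≤j⇒i<j {i} ℤ.≤-refl)

≤ᵇ-true : ∀ {i j} → i ℤ.≤ j → (i ≤ᵇ j) ≡ true
≤ᵇ-true h = Equivalence.to T-≡ (ℤ.≤⇒≤ᵇ h)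

≤ᵇ-false : ∀ {i j} → j ℤ.< i → (i ≤ᵇ j) ≡ false
≤ᵇ-false {i} {j} h with i ≤ᵇ j in eq
... | false = refl
... | true  = ⊥-elim (ℤ.<⇒≱ h (ℤ.≤ᵇ⇒≤ (Equivalence.from T-≡ eq)))

<ᵇ-true : ∀ {i j} → i ℤ.< j → (i <ᵇ j) ≡ true
<ᵇ-true {i} {j} h = ≤ᵇ-true (subst (ℤ._≤ j) (ℤ.+-comm 1ℤ i) (ℤ.i<j⇒suc[i]≤j h))

<ᵇ-false : ∀ {i j} → j ℤ.≤ i → (i <ᵇ j) ≡ false
<ᵇ-false {i} {j} h = ≤ᵇ-false (ℤ.≤-<-trans h (i<i+1 i))

𝟙 : Bool → ℤ
𝟙 b = if b then 1ℤ else 0ℤ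

isBottom-length : ∀ t m → length m ≢ length t → isBottom t m ≡ false
isBottom-length []           []           h = ⊥-elim (h refl)
isBottom-length []           (_ ∷ _)      h = refl
isBottom-length (_ ∷ [])     []           h = refl
isBottom-length (_ ∷ _ ∷ _)  []           h = refl
isBottom-length (_ ∷ [])     (_ ∷ [])     h = ⊥-elim (h refl)
isBottom-length (_ ∷ [])     (_ ∷ _ ∷ _)  h = refl
isBottom-length (_ ∷ _ ∷ _)  (_ ∷ [])     h = refl
isBottom-length (a ∷ a′ ∷ t) (b ∷ b′ ∷ m) h
  rewrite isBottom-length (a′ ∷ t) (b′ ∷ m) (h ∘ cong suc)
  with b ≤ᵇ a | b ≤ᵇ b′ | (if a <ᵇ a′ then b <ᵇ b′ else true)
... | false | _     | _     = refl
... | true  | false | _     = refl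
... | true  | true  | false = refl
... | true  | true  | true  = refl

module _ (LO : ℕ) where

  ι : ℕ → ℤ
  ι n = ℤ.+ n - ℤ.+ LO

  ι-≤ : ∀ {a b} → a ℕ.≤ b → ι a ℤ.≤ ι b
  ι-≤ h = ℤ.+-monoˡ-≤ (- (ℤ.+ LO)) (ℤ.+≤+ h)

  ι-< : ∀ {a b} → a ℕ.< b → ι a ℤ.< ι b
  ι-< h = ℤ.+-monoˡ-< (- (ℤ.+ LO)) (ℤ.+<+ h)

  -- The monomials visited by `Ms`, so that summands have to be compared only on these, which are
  -- weakly increasing.
  data From : ℕ → List ℤ → Set where
    []   : ∀ {j} → From j []
    here : ∀ {j m} → From j m → From j (ι j ∷ m)
    up   : ∀ {j m} → From (suc j) m → From j m

  From-head : ∀ {j b m} → From j (b ∷ m) → ι j ℤ.≤ b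
  From-head (here _) = ℤ.≤-refl
  From-head {j} (up F) = ℤ.≤-trans (ι-≤ (ℕ.n≤1+n j)) (From-head F)

  From-sorted : ∀ {j m} → From j m → Linked ℤ._≤_ m
  From-sorted []       = []
  From-sorted (up F)   = From-sorted F
  From-sorted {m = _ ∷ []} (here F) = [-]
  From-sorted {m = _ ∷ _ ∷ _} (here F) = From-head F ∷ From-sorted F

  From-replicate : ∀ k {j m} → From j m → From j (replicate k (ι j) ++ m)
  From-replicate zero    F = F
  From-replicate (suc k) F = here (From-replicate k F)

  module _ (x : ℕ → ℤ) where

    -- Σ f(m) x^m over the degree n monomials m in the variables j, …, j + r - 1.
    Ms : ℕ → ℕ → ℕ → (List ℤ → ℤ) → ℤ
    Ms zero    j zero    f = f []
    Ms zero    j (suc n) f = 0ℤ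
    Ms (suc r) j n       f = ∑ n (λ k → x j ^ k * Ms r (suc j) (n ∸ k) (λ m → f (replicate k (ι j) ++ m)))

    Ms-cong : ∀ r j n {f g} → (∀ m → From j m → length m ≡ n → f m ≡ g m) → Ms r j n f ≡ Ms r j n g
    Ms-cong zero    j zero    e = e [] [] refl
    Ms-cong zero    j (suc n) e = refl
    Ms-cong (suc r) j n       e = ∑-cong n (λ k h → cong (x j ^ k *_) (Ms-cong r (suc j) (n ∸ k)
      (λ m F l → e (replicate k (ι j) ++ m) (From-replicate k (up F))
        (trans (length-++ (replicate k (ι j))) (trans (cong₂ ℕ._+_ (length-replicate k) l) (ℕ.m+[n∸m]≡n h))))))

    Ms-linear : ∀ r j n f c g → Ms r j n (λ m → f m + c * g m) ≡ Ms r j n f + c * Ms r j n g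
    Ms-linear zero    j zero    f c g = refl
    Ms-linear zero    j (suc n) f c g = sym (trans (ℤ.+-identityˡ _) (ℤ.*-zeroʳ c))
    Ms-linear (suc r) j n       f c g =
      trans (∑-cong n (λ k _ → trans (cong (x j ^ k *_) (Ms-linear r (suc j) (n ∸ k) _ c _)) (ring (x j ^ k) c _ _)))
            (∑-linear n _ c _)
      where
      ring : ∀ y c p q → y * (p + c * q) ≡ y * p + c * (y * q)
      ring = solve-∀

    Ms-zero : ∀ r j n {f} → (∀ m → From j m → length m ≡ n → f m ≡ 0ℤ) → Ms r j n f ≡ 0ℤ
    Ms-zero zero    j zero    e = e [] [] refl
    Ms-zero zero    j (suc n) e = refl
    Ms-zero (suc r) j n       e = trans (Ms-cong (suc r) j n e)
      (∑-zero n (λ k → trans (cong (x j ^ k *_) (Ms-zero r (suc j) (n ∸ k) (λ _ _ _ → refl))) (ℤ.*-zeroʳ (x j ^ k))))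

    -- Either variable `j` is absent, or one copy is split off and `j` stays available.
    Ms-suc : ∀ r j n f → Ms (suc r) j (suc n) f ≡ Ms r (suc j) (suc n) f + x j * Ms (suc r) j n (λ m → f (ι j ∷ m))
    Ms-suc r j n f = cong₂ _+_ (ℤ.*-identityˡ (Ms r (suc j) (suc n) f))
      (trans (∑-cong n (λ k _ → ℤ.*-assoc (x j) (x j ^ k) (term k))) (∑-scale n (x j) (λ k → x j ^ k * term k)))
      where
      term : ℕ → ℤ
      term k = Ms r (suc j) (n ∸ k) (λ m → f (ι j ∷ replicate k (ι j) ++ m))

    bot : List ℕ → List ℤ → ℤ
    bot t m = 𝟙 (isBottom (map ι t) m)

    bot-drop : ∀ {j a} t m → j ℕ.≤ a → From (suc j) m → bot (a ∷ t) (ι j ∷ m) ≡ bot t m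
    bot-drop []      []      h F rewrite ≤ᵇ-true (ι-≤ h) = refl
    bot-drop []      (_ ∷ _) h F = refl
    bot-drop (b ∷ t) []      h F = cong 𝟙 (sym (isBottom-length (ι b ∷ map ι t) [] (λ ())))
    bot-drop {j} {a} (a′ ∷ t) (b ∷ m) h F
      rewrite ≤ᵇ-true (ι-≤ h)
            | ≤ᵇ-true (ℤ.<⇒≤ (ℤ.<-≤-trans (ι-< (ℕ.n<1+n j)) (From-head F)))
            | <ᵇ-true (ℤ.<-≤-trans (ι-< (ℕ.n<1+n j)) (From-head F))
      with ι a <ᵇ ι a′
    ... | true  = refl
    ... | false = refl

    bot-below : ∀ {j a} t m → a ℕ.< j → bot (a ∷ t) (ι j ∷ m) ≡ 0ℤ
    bot-below []      []      h rewrite ≤ᵇ-false (ι-< h) = refl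
    bot-below []      (_ ∷ _) h = refl
    bot-below (_ ∷ _) []      h = refl
    bot-below (_ ∷ _) (_ ∷ _) h rewrite ≤ᵇ-false (ι-< h) = refl

    bot-descent : ∀ {j a a′} t m → j ℕ.≤ a → a′ ℕ.< a → bot (a ∷ a′ ∷ t) (ι j ∷ ι j ∷ m) ≡ bot (a′ ∷ t) (ι j ∷ m)
    bot-descent {j} t m h h′
      rewrite ≤ᵇ-true (ι-≤ h) | ≤ᵇ-true (ℤ.≤-refl {ι j}) | <ᵇ-false (ℤ.<⇒≤ (ι-< h′)) = refl

    bot-ascent : ∀ {j a a′} t m → a ℕ.< a′ → bot (a ∷ a′ ∷ t) (ι j ∷ ι j ∷ m) ≡ 0ℤ
    bot-ascent {j} {a} t m h rewrite <ᵇ-true (ι-< h) | <ᵇ-false (ℤ.≤-refl {ι j}) with ι j ≤ᵇ ι a | ι j ≤ᵇ ι j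
    ... | true  | true  = refl
    ... | true  | false = refl
    ... | false | _     = refl

    -- The Billey-Jockusch-Stanley formula for one word: an entry b below a letter a means choosing
    -- x_b u_a from A_b(x_b), and letters sharing an entry come from one A_b, hence decrease. Equal
    -- neighbours are excluded because a bottom row may repeat an entry below them, while A_b uses
    -- each letter at most once.
    Ms-bot : ∀ r j t → Linked _≢_ t → All (ℕ._< r ℕ.+ j) t → Ms r j (length t) (bot t) ≡ Sch r j x (δ t) []
    -- The state of the computation after variable j was used for a letter c + j: as long as further copies
    -- of variable j are used, the letters have to decrease.
    Ms-bot-capped : ∀ r j c t f → c ℕ.≤ suc r → Linked _≢_ t → All (ℕ._< suc r ℕ.+ j) t →
      (∀ m → From (suc j) m → f m ≡ bot t m) →
      (∀ {a t′} m → t ≡ a ∷ t′ → a ℕ.< c ℕ.+ j → f (ι j ∷ m) ≡ bot t (ι j ∷ m)) →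
      (∀ {a t′} m → t ≡ a ∷ t′ → c ℕ.+ j ℕ.≤ a → f (ι j ∷ m) ≡ 0ℤ) →
      Ms (suc r) j (length t) f ≡ Sch r (suc j) x (Ad c j (x j) (δ t)) []

    Ms-bot zero    j []      ne bd = refl
    Ms-bot zero    j (_ ∷ _) ne bd = refl
    -- Initially the cap suc r + j exceeds every letter, so nothing is restricted.
    Ms-bot (suc r) j t       ne bd = Ms-bot-capped r j (suc r) t (bot t) ℕ.≤-refl ne bd (λ _ _ → refl) (λ _ _ _ → refl)
      (λ { m refl h → ⊥-elim (ℕ.<⇒≱ (All.head bd) h) })

    Ms-bot-capped r j c [] f _ ne bd f₁ f₂ f₃ =
      trans (ℤ.*-identityˡ _)
      (trans (Ms-cong r (suc j) 0 (λ m F _ → f₁ m F))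
      (trans (Ms-bot r (suc j) [] [] []) (sym (Sch-cong r (suc j) x (Ad-δ-[] c j (x j)) []))))
    Ms-bot-capped r j c (a ∷ t) f c≤ ne bd f₁ f₂ f₃ =
      trans (Ms-suc r j (length t) f)
      (trans (cong (_+ x j * Ms (suc r) j (length t) (f ∘ (ι j ∷_)))
         (trans (Ms-cong r (suc j) _ (λ m F _ → f₁ m F))
                (Ms-bot r (suc j) (a ∷ t) ne (All.map (λ {b} → subst (b ℕ.<_) (sym (ℕ.+-suc r j))) bd))))
      rest)
      where
      S = Sch r (suc j) x (δ (a ∷ t)) []
      drop-zero : (∀ m → f (ι j ∷ m) ≡ 0ℤ) → Ad c j (x j) (δ (a ∷ t)) ≐ δ (a ∷ t) →
        S + x j * Ms (suc r) j (length t) (f ∘ (ι j ∷_)) ≡ Sch r (suc j) x (Ad c j (x j) (δ (a ∷ t))) []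
      drop-zero z e = trans (cong (λ q → S + x j * q) (Ms-zero (suc r) j (length t) (λ m _ _ → z m)))
        (trans (cong (S +_) (ℤ.*-zeroʳ (x j))) (trans (ℤ.+-identityʳ S) (sym (Sch-cong r (suc j) x e []))))
      cap : (i : ℕ) → i ℕ.+ j ≡ a → i ℕ.< c →
        Ms (suc r) j (length t) (f ∘ (ι j ∷_)) ≡ Sch r (suc j) x (Ad i j (x j) (δ t)) []
      cap i refl i<c = Ms-bot-capped r j i t (f ∘ (ι j ∷_)) (ℕ.≤-trans (ℕ.<⇒≤ i<c) c≤) (Linked.tail ne) (All.tail bd)
        (λ m F → trans (fa m) (bot-drop t m (ℕ.m≤n+m j i) F))
        (λ { {t′ = t′} m refl h → trans (fa (ι j ∷ m)) (bot-descent t′ m (ℕ.m≤n+m j i) h) })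
        (λ { {t′ = t′} m refl h → trans (fa (ι j ∷ m)) (bot-ascent t′ m (ℕ.≤∧≢⇒< h (Linked.head ne))) })
        where
        fa : ∀ m → f (ι j ∷ m) ≡ bot (a ∷ t) (ι j ∷ m)
        fa m = f₂ m refl (ℕ.+-monoˡ-< j i<c)
      rest : S + x j * Ms (suc r) j (length t) (f ∘ (ι j ∷_)) ≡ Sch r (suc j) x (Ad c j (x j) (δ (a ∷ t))) []
      -- Variable `j` can serve the letter `a` exactly when j ≤ a < c + j; the cap then drops from c
      -- to a - j.
      rest with a ℕ.<? c ℕ.+ j
      ... | no a≮ = drop-zero (λ m → f₃ m refl (ℕ.≮⇒≥ a≮)) (Ad-δ-above c j (x j) t (ℕ.≮⇒≥ a≮))
      ... | yes a< with a ℕ.<? j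
      ...   | yes a<j = drop-zero (λ m → trans (f₂ m refl a<) (bot-below t m a<j)) (Ad-δ-below c j (x j) t a<j)
      ...   | no a≮j = trans (cong (λ q → S + x j * q) (cap i i+j i<c))
                (sym (trans (Sch-cong r (suc j) x split []) (Sch-linear r (suc j) x (δ (a ∷ t)) (x j) (Ad i j (x j) (δ t)) [])))
        where
        i = a ∸ j
        i+j : i ℕ.+ j ≡ a
        i+j = ℕ.m∸n+n≡m (ℕ.≮⇒≥ a≮j)
        i<c : i ℕ.< c
        i<c = ℕ.+-cancelʳ-< j i c (subst (ℕ._< c ℕ.+ j) (sym i+j) a<)
        split : Ad c j (x j) (δ (a ∷ t)) ≐ (λ s → δ (a ∷ t) s + x j * Ad i j (x j) (δ t) s)
        split = subst (λ b → Ad c j (x j) (δ (b ∷ t)) ≐ (λ s → δ (b ∷ t) s + x j * Ad i j (x j) (δ t) s)) i+j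
                  (Ad-δ-in c j (x j) i t i<c)

-- Products of coefficient functions

total : List (ℤ × ℕ) → ℕ
total []             = 0
total ((_ , k) ∷ rs) = k ℕ.+ total rs

total-runs : ∀ m → total (runs m) ≡ length m
total-runs []      = refl
total-runs (a ∷ m) with runs m | total-runs m
... | []           | e = cong suc e
... | (b , k) ∷ rs | e with a ℤ.≟ b
...   | yes _ = cong suc e
...   | no  _ = cong suc e

splitRuns-length : ∀ rs → All (λ ab → length (proj₁ ab) ℕ.+ length (proj₂ ab) ≡ total rs) (splitRuns rs)
splitRuns-length []             = refl ∷ []
splitRuns-length ((a , k) ∷ rs) = All.concat⁺ (All.map⁺ (All.applyUpTo⁺₁ (λ i → i) (suc k)
  (λ {i} i<1+k → All.map⁺ (All.map (λ {ab} → glue i (ℕ.≤-pred i<1+k) ab) (splitRuns-length rs)))))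
  where
  glue : ∀ i → i ℕ.≤ k → ∀ ab → length (proj₁ ab) ℕ.+ length (proj₂ ab) ≡ total rs →
    length (replicate i a ++ proj₁ ab) ℕ.+ length (replicate (k ∸ i) a ++ proj₂ ab) ≡ k ℕ.+ total rs
  glue i h (p , q) e = trans (cong₂ ℕ._+_ (trans (length-++ (replicate i a)) (cong (ℕ._+ length p) (length-replicate i)))
      (trans (length-++ (replicate (k ∸ i) a)) (cong (ℕ._+ length q) (length-replicate (k ∸ i)))))
    (trans (shuffle i (length p) (k ∸ i) (length q)) (cong₂ ℕ._+_ (ℕ.m+[n∸m]≡n h) e))
    where
    shuffle : ∀ i p l q → (i ℕ.+ p) ℕ.+ (l ℕ.+ q) ≡ (i ℕ.+ l) ℕ.+ (p ℕ.+ q)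
    shuffle = ℕ-Ring.solve-∀

sum-zero : ∀ {A : Set} {h : A → ℕ} {xs} → All (λ y → h y ≡ 0) xs → sum (map h xs) ≡ 0
sum-zero []      = refl
sum-zero (e ∷ z) = cong₂ ℕ._+_ e (sum-zero z)

Graded : ℕ → (List ℤ → ℕ) → Set
Graded p f = ∀ m → length m ≢ p → f m ≡ 0

prodCoeff-graded : ∀ {p q f g} → Graded p f → Graded q g → Graded (p ℕ.+ q) (prodCoeff f g)
prodCoeff-graded {p} {q} {f} {g} hf hg m ne =
  sum-zero (All.map (λ {ab} → vanishes ab) (splitRuns-length (runs m)))
  where
  vanishes : ∀ ab → length (proj₁ ab) ℕ.+ length (proj₂ ab) ≡ total (runs m) → f (proj₁ ab) ℕ.* g (proj₂ ab) ≡ 0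
  vanishes (a , b) e with length a ℕ.≟ p
  ... | no h = cong (ℕ._* g b) (hf a h)
  ... | yes refl = trans (cong (f a ℕ.*_) (hg b (λ { refl → ne (trans (sym (total-runs m)) (sym e)) }))) (ℕ.*-zeroʳ (f a))

prodCoeff-zeroˡ : ∀ {f g} → (∀ m → f m ≡ 0) → ∀ m → prodCoeff f g m ≡ 0
prodCoeff-zeroˡ {g = g} z m = sum-zero (All.universal (λ ab → cong (ℕ._* g (proj₂ ab)) (z (proj₁ ab))) (splitRuns (runs m)))

prodCoeff-zeroʳ : ∀ {f g} → (∀ m → g m ≡ 0) → ∀ m → prodCoeff f g m ≡ 0
prodCoeff-zeroʳ {f = f} z m =
  sum-zero (All.universal (λ ab → trans (cong (f (proj₁ ab) ℕ.*_) (z (proj₂ ab))) (ℕ.*-zeroʳ (f (proj₁ ab)))) (splitRuns (runs m)))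

sum-concatMap : ∀ {A B : Set} (h : B → ℕ) (φ : A → List B) xs →
  sum (map h (concatMap φ xs)) ≡ sum (map (λ y → sum (map h (φ y))) xs)
sum-concatMap h φ []       = refl
sum-concatMap h φ (y ∷ ys) = trans (cong sum (map-++ h (φ y) (concatMap φ ys)))
  (trans (sum-++ (map h (φ y)) (map h (concatMap φ ys))) (cong (sum (map h (φ y)) ℕ.+_) (sum-concatMap h φ ys)))

sum-applyUpTo : ∀ (F G : ℕ → ℕ) k → ℤ.+ sum (map F (applyUpTo G (suc k))) ≡ ∑ k (λ i → ℤ.+ F (G i))
sum-applyUpTo F G zero    = cong ℤ.+_ (ℕ.+-identityʳ (F (G 0)))
sum-applyUpTo F G (suc k) = trans (ℤ.pos-+ (F (G 0)) _) (cong (ℤ.+ F (G 0) +_) (sum-applyUpTo F (G ∘ suc) k))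

runs-head : ∀ a m → ∃₂ λ k rs → runs (a ∷ m) ≡ (a , k) ∷ rs
runs-head a m with runs m
... | []           = 1 , [] , refl
... | (b , k) ∷ rs with a ℤ.≟ b
...   | yes refl = suc k , rs , refl
...   | no _     = 1 , (b , k) ∷ rs , refl

runs-∷-new : ∀ v m → (∀ {b m′} → m ≡ b ∷ m′ → v ≢ b) → runs (v ∷ m) ≡ (v , 1) ∷ runs m
runs-∷-new v []      h = refl
runs-∷-new v (b ∷ m) h with runs (b ∷ m) | runs-head b m
... | _ | k , rs , refl with v ℤ.≟ b
...   | yes e = ⊥-elim (h refl e)
...   | no _  = refl

runs-∷-same : ∀ v m {k rs} → runs m ≡ (v , k) ∷ rs → runs (v ∷ m) ≡ (v , suc k) ∷ rs
runs-∷-same v m e with runs m | e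
... | _ | refl with v ℤ.≟ v
...   | yes _ = refl
...   | no h  = ⊥-elim (h refl)

runs-replicate : ∀ k v m → (∀ {b m′} → m ≡ b ∷ m′ → v ≢ b) → runs (replicate (suc k) v ++ m) ≡ (v , suc k) ∷ runs m
runs-replicate zero    v m h = runs-∷-new v m h
runs-replicate (suc k) v m h = runs-∷-same v (replicate (suc k) v ++ m) (runs-replicate k v m h)

-- As `m` does not start with `v`, the copies form a run of their own, which is divided
-- independently of the other runs.
prodCoeff-replicate : ∀ k v m f g → (∀ {b m′} → m ≡ b ∷ m′ → v ≢ b) →
  ℤ.+ prodCoeff f g (replicate k v ++ m)
  ≡ ∑ k (λ i → ℤ.+ prodCoeff (f ∘ (replicate i v ++_)) (g ∘ (replicate (k ∸ i) v ++_)) m)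
prodCoeff-replicate zero    v m f g h = refl
prodCoeff-replicate (suc k) v m f g h rewrite runs-replicate k v m h =
  trans (cong ℤ.+_ (sum-concatMap pair (λ i → map (glue i) (splitRuns (runs m))) (upTo (suc (suc k)))))
  (trans (sum-applyUpTo (λ i → sum (map pair (map (glue i) (splitRuns (runs m))))) (λ i → i) (suc k))
  (∑-cong (suc k) (λ i _ → cong (ℤ.+_ ∘ sum) (sym (map-∘ {g = pair} {f = glue i} (splitRuns (runs m)))))))
  where
  pair : List ℤ × List ℤ → ℕ
  pair ab = f (proj₁ ab) ℕ.* g (proj₂ ab)
  glue : ℕ → List ℤ × List ℤ → List ℤ × List ℤ
  glue i ab = replicate i v ++ proj₁ ab , replicate (suc k ∸ i) v ++ proj₂ ab

∑-head : ∀ n {B} → (∀ l → B (suc l) ≡ 0ℤ) → ∑ n B ≡ B 0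
∑-head zero    z = refl
∑-head (suc n) {B} z = trans (cong (B 0 +_) (∑-zero n z)) (ℤ.+-identityʳ (B 0))

∑-tail : ∀ q n {B} → (∀ l → q ℕ.< l → B l ≡ 0ℤ) → ∑ (q ℕ.+ n) B ≡ ∑ q B
∑-tail zero    n z = ∑-head n (λ l → z (suc l) (s≤s z≤n))
∑-tail (suc q) n {B} z = cong (B 0 +_) (∑-tail q n (λ l h → z (suc l) (s≤s h)))

-- The triangle i + l ≤ p + q contains the whole rectangle i ≤ p, l ≤ q, outside of which the terms
-- vanish.
cauchy-product : ∀ p q {A B} → (∀ i → p ℕ.< i → A i ≡ 0ℤ) → (∀ l → q ℕ.< l → B l ≡ 0ℤ) →
  ∑ (p ℕ.+ q) (λ k → ∑ k (λ i → A i * B (k ∸ i))) ≡ ∑ p A * ∑ q B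
cauchy-product zero q {A} {B} hA hB =
  trans (∑-cong q (λ k _ → ∑-head k (λ l → cong (_* B (k ∸ suc l)) (hA (suc l) (s≤s z≤n))))) (∑-scale q (A 0) B)
cauchy-product (suc p) q {A} {B} hA hB =
  trans (cong (A 0 * B 0 +_) (trans (split (p ℕ.+ q)) (cong (∑ (p ℕ.+ q) (λ k → A 0 * B (suc k)) +_)
      (cauchy-product p q (λ i h → hA (suc i) (s≤s h)) hB))))
  (trans (sym (ℤ.+-assoc (A 0 * B 0) _ _))
  (trans (cong (_+ ∑ p (A ∘ suc) * ∑ q B) (trans (∑-scale (suc (p ℕ.+ q)) (A 0) B)
      (cong (A 0 *_) (trans (cong (λ z → ∑ z B) (trans (cong suc (ℕ.+-comm p q)) (sym (ℕ.+-suc q p)))) (∑-tail q (suc p) hB)))))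
  (sym (ℤ.*-distribʳ-+ (∑ q B) (A 0) (∑ p (A ∘ suc))))))
  where
  split : ∀ n → ∑ n (λ k → A 0 * B (suc k) + ∑ k (λ i → A (suc i) * B (k ∸ i)))
    ≡ ∑ n (λ k → A 0 * B (suc k)) + ∑ n (λ k → ∑ k (λ i → A (suc i) * B (k ∸ i)))
  split n = trans (∑-cong n (λ k _ → cong (A 0 * B (suc k) +_) (sym (ℤ.*-identityˡ _))))
    (trans (∑-linear n _ 1ℤ _) (cong (∑ n (λ k → A 0 * B (suc k)) +_) (ℤ.*-identityˡ _)))

module _ (LO : ℕ) (x : ℕ → ℤ) where

  Ms-∑ : ∀ r j n k (F : ℕ → List ℤ → ℤ) → Ms LO x r j n (λ m → ∑ k (λ i → F i m)) ≡ ∑ k (λ i → Ms LO x r j n (F i))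
  Ms-∑ r j n zero    F = refl
  Ms-∑ r j n (suc k) F =
    trans (Ms-cong LO x r j n (λ m _ _ → cong (F 0 m +_) (sym (ℤ.*-identityˡ _))))
    (trans (Ms-linear LO x r j n (F 0) 1ℤ _)
    (cong (Ms LO x r j n (F 0) +_) (trans (ℤ.*-identityˡ _) (Ms-∑ r j n k (F ∘ suc)))))

  -- Sorted by powers of x_j the claim is a Cauchy product whose coefficients multiply by induction
  -- on the number of variables.
  Ms-product : ∀ r j p q f g → Graded p f → Graded q g →
    Ms LO x r j (p ℕ.+ q) (ℤ.+_ ∘ prodCoeff f g) ≡ Ms LO x r j p (ℤ.+_ ∘ f) * Ms LO x r j q (ℤ.+_ ∘ g)
  Ms-product zero j zero    zero    f g hf hg = trans (cong ℤ.+_ (ℕ.+-identityʳ _)) (ℤ.pos-* (f []) (g []))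
  Ms-product zero j zero    (suc q) f g hf hg = sym (ℤ.*-zeroʳ (ℤ.+ f []))
  Ms-product zero j (suc p) q       f g hf hg = sym (ℤ.*-zeroˡ (Ms LO x zero j q (ℤ.+_ ∘ g)))
  Ms-product (suc r) j p q f g hf hg =
    trans (∑-cong (p ℕ.+ q) (λ k _ → row k))
      (cauchy-product p q (λ i h → trans (cong (x j ^ i *_) (Φ-zero i h)) (ℤ.*-zeroʳ (x j ^ i)))
                          (λ l h → trans (cong (x j ^ l *_) (Γ-zero l h)) (ℤ.*-zeroʳ (x j ^ l))))
    where
    v = ι LO j
    shift : (List ℤ → ℕ) → ℕ → List ℤ → ℕ
    shift f i m = f (replicate i v ++ m)
    shift-length : ∀ i m → length (replicate i v ++ m) ≡ i ℕ.+ length m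
    shift-length i m = trans (length-++ (replicate i v)) (cong (ℕ._+ length m) (length-replicate i))
    shift-graded : ∀ {p f} i → Graded p f → Graded (p ∸ i) (shift f i)
    shift-graded i h m ne = h _ (λ e → ne (trans (sym (ℕ.m+n∸m≡n i (length m))) (cong (_∸ i) (trans (sym (shift-length i m)) e))))
    shift-zero : ∀ {p f} i → Graded p f → p ℕ.< i → ∀ m → shift f i m ≡ 0
    shift-zero i h p<i m = h _ (λ e → ℕ.<⇒≢ (ℕ.<-≤-trans p<i (ℕ.m≤m+n i (length m))) (sym (trans (sym (shift-length i m)) e)))
    Φ Γ : ℕ → ℤ
    Φ i = Ms LO x r (suc j) (p ∸ i) (ℤ.+_ ∘ shift f i)
    Γ l = Ms LO x r (suc j) (q ∸ l) (ℤ.+_ ∘ shift g l)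
    Φ-zero : ∀ i → p ℕ.< i → Φ i ≡ 0ℤ
    Φ-zero i h = Ms-zero LO x r (suc j) (p ∸ i) (λ m _ _ → cong ℤ.+_ (shift-zero i hf h m))
    Γ-zero : ∀ i → q ℕ.< i → Γ i ≡ 0ℤ
    Γ-zero i h = Ms-zero LO x r (suc j) (q ∸ i) (λ m _ _ → cong ℤ.+_ (shift-zero i hg h m))
    degree : ∀ {i l} → i ℕ.≤ p → l ℕ.≤ q → p ℕ.+ q ∸ (i ℕ.+ l) ≡ (p ∸ i) ℕ.+ (q ∸ l)
    degree {i} {l} h h′ = trans (sym (ℕ.∸-+-assoc (p ℕ.+ q) i l))
      (trans (cong (_∸ l) (ℕ.+-∸-comm q h)) (ℕ.+-∸-assoc (p ∸ i) h′))
    -- If i > p or l > q, truncated subtraction loses the degree, but then a shifted factor is zero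
    -- and so are both sides.
    term : ∀ i l → Ms LO x r (suc j) (p ℕ.+ q ∸ (i ℕ.+ l)) (ℤ.+_ ∘ prodCoeff (shift f i) (shift g l)) ≡ Φ i * Γ l
    term i l with i ℕ.≤? p | l ℕ.≤? q
    ... | yes h | yes h′ = trans (cong (λ n → Ms LO x r (suc j) n (ℤ.+_ ∘ prodCoeff (shift f i) (shift g l))) (degree h h′))
            (Ms-product r (suc j) (p ∸ i) (q ∸ l) (shift f i) (shift g l) (shift-graded i hf) (shift-graded l hg))
    ... | no h | _ = trans (Ms-zero LO x r (suc j) _ (λ m _ _ → cong ℤ.+_ (prodCoeff-zeroˡ (shift-zero i hf (ℕ.≰⇒> h)) m)))
            (sym (trans (cong (_* Γ l) (Φ-zero i (ℕ.≰⇒> h))) (ℤ.*-zeroˡ (Γ l))))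
    ... | yes _ | no h = trans (Ms-zero LO x r (suc j) _ (λ m _ _ → cong ℤ.+_ (prodCoeff-zeroʳ {f = shift f i} (shift-zero l hg (ℕ.≰⇒> h)) m)))
            (sym (trans (cong (Φ i *_) (Γ-zero l (ℕ.≰⇒> h))) (ℤ.*-zeroʳ (Φ i))))
    From-new : ∀ {m} → From LO (suc j) m → ∀ {b m′} → m ≡ b ∷ m′ → v ≢ b
    From-new F refl e = ℤ.<⇒≢ (ℤ.<-≤-trans (ι-< LO (ℕ.n<1+n j)) (From-head LO F)) e
    power : ∀ i l y z → x j ^ (i ℕ.+ l) * (y * z) ≡ (x j ^ i * y) * (x j ^ l * z)
    power i l y z = trans (cong (_* (y * z)) (ℤ.^-distribˡ-+-* (x j) i l)) (ring (x j ^ i) (x j ^ l) y z)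
      where
      ring : ∀ a b y z → (a * b) * (y * z) ≡ (a * y) * (b * z)
      ring = solve-∀
    row : ∀ k → x j ^ k * Ms LO x r (suc j) (p ℕ.+ q ∸ k) (λ m → ℤ.+ prodCoeff f g (replicate k v ++ m))
      ≡ ∑ k (λ i → (x j ^ i * Φ i) * (x j ^ (k ∸ i) * Γ (k ∸ i)))
    row k = trans (cong (x j ^ k *_) (trans (Ms-cong LO x r (suc j) _ (λ m F _ → prodCoeff-replicate k v m f g (From-new F)))
        (Ms-∑ r (suc j) _ k (λ i m → ℤ.+ prodCoeff (shift f i) (shift g (k ∸ i)) m))))
      (trans (sym (∑-scale k (x j ^ k) _))
      (∑-cong k (λ i h → trans (cong (λ z → x j ^ z * Ms LO x r (suc j) (p ℕ.+ q ∸ z) (ℤ.+_ ∘ prodCoeff (shift f i) (shift g (k ∸ i)))) (sym (ℕ.m+[n∸m]≡n h)))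
        (trans (cong (x j ^ (i ℕ.+ (k ∸ i)) *_) (term i (k ∸ i))) (power i (k ∸ i) (Φ i) (Γ (k ∸ i)))))))

-- Reduced words

i≢i+1 : ∀ i → i ≢ i + 1ℤ
i≢i+1 i = ℤ.<⇒≢ (i<i+1 i)

s-left : ∀ i → s i i ≡ i + 1ℤ
s-left i with i ℤ.≟ i
... | yes _ = refl
... | no h  = ⊥-elim (h refl)

s-right : ∀ i → s i (i + 1ℤ) ≡ i
s-right i with (i + 1ℤ) ℤ.≟ i
... | yes e = ⊥-elim (i≢i+1 i (sym e))
... | no _ with (i + 1ℤ) ℤ.≟ (i + 1ℤ)
...   | yes _ = refl
...   | no h  = ⊥-elim (h refl)

s-fix : ∀ {i j} → j ≢ i → j ≢ i + 1ℤ → s i j ≡ j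
s-fix {i} {j} h h′ with j ℤ.≟ i
... | yes e = ⊥-elim (h e)
... | no _ with j ℤ.≟ (i + 1ℤ)
...   | yes e = ⊥-elim (h′ e)
...   | no _  = refl

s-involutive : ∀ i j → s i (s i j) ≡ j
s-involutive i j with j ℤ.≟ i
... | yes refl = s-right i
... | no h with j ℤ.≟ (i + 1ℤ)
...   | yes refl = s-left i
...   | no h′ = s-fix h h′

+1-injective : ∀ {i j} → i + 1ℤ ≡ j + 1ℤ → i ≡ j
+1-injective {i} {j} = ℤ-Group.∙-cancelʳ 1ℤ i j

s-comm : ∀ {a b} → a + 1ℤ ℤ.< b → ∀ j → s a (s b j) ≡ s b (s a j)
s-comm {a} {b} h j = go j (j ℤ.≟ a) (j ℤ.≟ (a + 1ℤ)) (j ℤ.≟ b) (j ℤ.≟ (b + 1ℤ))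
  where
  a+1≢b = ℤ.<⇒≢ h
  a<b : a ℤ.< b
  a<b = ℤ.<-trans (i<i+1 a) h
  a≢b = ℤ.<⇒≢ a<b
  a≢b+1 = ℤ.<⇒≢ (ℤ.<-trans a<b (i<i+1 b))
  go : ∀ j → Dec (j ≡ a) → Dec (j ≡ a + 1ℤ) → Dec (j ≡ b) → Dec (j ≡ b + 1ℤ) → s a (s b j) ≡ s b (s a j)
  go j (yes refl) _ _ _ = trans (cong (s a) (s-fix a≢b a≢b+1)) (trans (s-left a) (sym (trans (cong (s b) (s-left a)) (s-fix a+1≢b (a≢b ∘ +1-injective)))))
  go j (no _) (yes refl) _ _ = trans (cong (s a) (s-fix a+1≢b (a≢b ∘ +1-injective))) (trans (s-right a) (sym (trans (cong (s b) (s-right a)) (s-fix a≢b a≢b+1))))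
  go j (no _) (no _) (yes refl) _ = trans (cong (s a) (s-left b)) (trans (s-fix (a≢b+1 ∘ sym) (a≢b ∘ sym ∘ +1-injective)) (sym (trans (cong (s b) (s-fix (a≢b ∘ sym) (a+1≢b ∘ sym))) (s-left b))))
  go j (no _) (no _) (no _) (yes refl) = trans (cong (s a) (s-right b)) (trans (s-fix (a≢b ∘ sym) (a+1≢b ∘ sym)) (sym (trans (cong (s b) (s-fix (a≢b+1 ∘ sym) (a≢b ∘ sym ∘ +1-injective))) (s-right b))))
  go j (no p) (no q) (no r) (no t) = trans (cong (s a) (s-fix r t)) (trans (s-fix p q) (sym (trans (cong (s b) (s-fix p q)) (s-fix r t))))

s-braid : ∀ a j → s a (s (a + 1ℤ) (s a j)) ≡ s (a + 1ℤ) (s a (s (a + 1ℤ) j))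
s-braid a j = go j (j ℤ.≟ a) (j ℤ.≟ b) (j ℤ.≟ c)
  where
  b = a + 1ℤ
  c = b + 1ℤ
  a≢b = i≢i+1 a
  b≢c = i≢i+1 b
  a≢c : a ≢ c
  a≢c = ℤ.<⇒≢ (ℤ.<-trans (i<i+1 a) (i<i+1 b))
  sbc : s a c ≡ c
  sbc = s-fix (a≢c ∘ sym) (b≢c ∘ sym)
  sba : s b a ≡ a
  sba = s-fix a≢b a≢c
  go : ∀ j → Dec (j ≡ a) → Dec (j ≡ b) → Dec (j ≡ c) → s a (s b (s a j)) ≡ s b (s a (s b j))
  go j (yes refl) _ _ = trans (cong (s a ∘ s b) (s-left a)) (trans (cong (s a) (s-left b)) (trans sbc
    (sym (trans (cong (s b ∘ s a) sba) (trans (cong (s b) (s-left a)) (s-left b))))))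
  go j (no _) (yes refl) _ = trans (cong (s a ∘ s b) (s-right a)) (trans (cong (s a) sba) (trans (s-left a)
    (sym (trans (cong (s b ∘ s a) (s-left b)) (trans (cong (s b) sbc) (s-right b))))))
  go j (no _) (no _) (yes refl) = trans (cong (s a ∘ s b) sbc) (trans (cong (s a) (s-right b)) (trans (s-right a)
    (sym (trans (cong (s b ∘ s a) (s-right b)) (trans (cong (s b) (s-right a)) sba)))))
  go j (no p) (no q) (no r) = trans (cong (s a ∘ s b) (s-fix p q)) (trans (cong (s a) (s-fix q r)) (trans (s-fix p q)
    (sym (trans (cong (s b ∘ s a) (s-fix q r)) (trans (cong (s b) (s-fix p q)) (s-fix q r))))))

prod-++ : ∀ p q j → prod (p ++ q) j ≡ prod p (prod q j)
prod-++ []      q j = refl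
prod-++ (a ∷ p) q j = cong (s a) (prod-++ p q j)

prod-context : ∀ p {r r′} q → (∀ j → prod r j ≡ prod r′ j) → ∀ j → prod (p ++ r ++ q) j ≡ prod (p ++ r′ ++ q) j
prod-context p {r} {r′} q e j =
  trans (prod-++ p (r ++ q) j) (trans (cong (prod p) (trans (prod-++ r q j) (trans (e (prod q j)) (sym (prod-++ r′ q j)))))
    (sym (prod-++ p (r′ ++ q) j)))

length-context : ∀ {A : Set} (p : List A) {r r′} q → length r ≡ length r′ → length (p ++ r ++ q) ≡ length (p ++ r′ ++ q)
length-context p {r} {r′} q e = trans (length-++ p) (trans (cong (length p ℕ.+_) (trans (length-++ r) (trans (cong (ℕ._+ length q) e) (sym (length-++ r′))))) (sym (length-++ p)))

reduced-context : ∀ {w} p {r r′} q → (∀ j → prod r j ≡ prod r′ j) → length r ≡ length r′ →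
  IsReducedWord w (p ++ r ++ q) → IsReducedWord w (p ++ r′ ++ q)
reduced-context p {r} {r′} q e l (word , minimal) =
  (λ j → trans (sym (prod-context p q e j)) (word j)) ,
  (λ t′ h → subst (ℕ._≤ length t′) (length-context p q l) (minimal t′ h))

reduced-no-square : ∀ {w} p a q → ¬ IsReducedWord w (p ++ a ∷ a ∷ q)
reduced-no-square p a q (word , minimal) =
  ℕ.<⇒≱ shorter (minimal (p ++ q) (λ j → trans (sym (prod-context p {a ∷ a ∷ []} {[]} q (s-involutive a) j)) (word j)))
  where
  shorter : length (p ++ q) ℕ.< length (p ++ a ∷ a ∷ q)
  shorter = subst₂ ℕ._<_ (sym (length-++ p)) (sym (length-++ p))
    (ℕ.+-monoʳ-< (length p) (ℕ.m<n⇒m<1+n (ℕ.n<1+n (length q))))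

reduced-same-length : ∀ w t t′ → IsReducedWord w t → IsReducedWord w t′ → length t ≡ length t′
reduced-same-length w t t′ (word , minimal) (word′ , minimal′) = ℕ.≤-antisym (minimal t′ word′) (minimal′ t word)

-- Bubble sort: composing with successive simple transpositions raises the value at `K` until it
-- equals `K`; then `K` is fixed and the bound drops by one.
word-of-injective : ∀ K (f : ℤ → ℤ) → (∀ {i j} → f i ≡ f j → i ≡ j) → (∀ j → j ℤ.≤ 0ℤ → f j ≡ j) →
  (∀ j → ℤ.+ K ℤ.< j → f j ≡ j) → ∃ λ t → ∀ j → prod t j ≡ f j
word-of-injective zero f inj low high = [] , λ j → sym (fixed j)
  where
  fixed : ∀ j → f j ≡ j
  fixed j with ℤ.≤-total j 0ℤ
  ... | inj₁ h = low j h
  ... | inj₂ h with 0ℤ ℤ.≟ j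
  ...   | yes refl = low 0ℤ ℤ.≤-refl
  ...   | no 0≢j = high j (ℤ.≤∧≢⇒< h 0≢j)
word-of-injective (suc K) f inj low high = from (f (ℤ.+ suc K)) refl
  where
  move : ∀ gap m (f : ℤ → ℤ) → (∀ {i j} → f i ≡ f j → i ≡ j) → (∀ j → j ℤ.≤ 0ℤ → f j ≡ j) →
    (∀ j → ℤ.+ suc K ℤ.< j → f j ≡ j) → f (ℤ.+ suc K) ≡ ℤ.+ suc m → gap ℕ.+ m ≡ K → ∃ λ t → ∀ j → prod t j ≡ f j
  move zero m f inj low high e m≡K = word-of-injective K f inj low above
    where
    above : ∀ j → ℤ.+ K ℤ.< j → f j ≡ j
    above j h with j ℤ.≟ ℤ.+ suc K
    ... | yes refl = trans e (cong (ℤ.+_ ∘ suc) m≡K)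
    ... | no ne = high j (ℤ.≤∧≢⇒< (ℤ.i<j⇒suc[i]≤j h) (ne ∘ sym))
  move (suc gap) m f inj low high e eq with
    move gap (suc m) (s a ∘ f) (λ {i} {j} q → inj (trans (sym (s-involutive a (f i))) (trans (cong (s a) q) (s-involutive a (f j)))))
      (λ j h → trans (cong (s a) (low j h)) (s-fix (λ { refl → ℤ.<⇒≱ (ℤ.+<+ (s≤s z≤n)) h }) (λ { refl → ℤ.<⇒≱ (ℤ.+<+ (s≤s z≤n)) h })))
      (λ j h → trans (cong (s a) (high j h)) (s-fix (λ { refl → ℤ.<-asym h (ℤ.+<+ (s≤s m<K)) })
         (λ { refl → ℤ.<⇒≱ h (ℤ.+≤+ (s≤s (subst (ℕ._≤ K) (ℕ.+-comm 1 m) m<K))) })))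
      (trans (cong (s a) e) (trans (s-left a) (cong (ℤ.+_ ∘ suc) (ℕ.+-comm m 1)))) (trans (ℕ.+-suc gap m) eq)
    where
    a = ℤ.+ suc m
    m<K : m ℕ.< K
    m<K = subst (m ℕ.<_) eq (s≤s (ℕ.m≤n+m m gap))
  ... | t , word = ℤ.+ suc m ∷ t , λ j → trans (cong (s (ℤ.+ suc m)) (word j)) (s-involutive (ℤ.+ suc m) (f j))
  -- By injectivity the value at suc K is none of the fixed points ≤ 0 or > suc K.
  from : ∀ v → f (ℤ.+ suc K) ≡ v → ∃ λ t → ∀ j → prod t j ≡ f j
  from (ℤ.+ zero) e with inj (trans e (sym (low 0ℤ ℤ.≤-refl)))
  ... | ()
  from ℤ.-[1+ n ] e with inj (trans e (sym (low ℤ.-[1+ n ] ℤ.-≤+)))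
  ... | ()
  from (ℤ.+ suc m) e with m ℕ.≤? K
  ... | yes h = move (K ∸ m) m f inj low high e (ℕ.m∸n+n≡m h)
  ... | no h with inj (trans e (sym (high (ℤ.+ suc m) (ℤ.+<+ (s≤s (ℕ.≰⇒> h))))))
  ...   | refl = ⊥-elim (h ℕ.≤-refl)

word-of : ∀ u → InSZ+ u → ∃ (IsWordOf u)
word-of u low = word-of-injective K (fun u) (λ {i} {j} e → trans (sym (inv∘fun u i)) (trans (cong (inv u) e) (inv∘fun u j)))
  low (λ j h → fixes u j (outside j h))
  where
  K = max 0 (map ∣_∣ (support u))
  outside : ∀ j → ℤ.+ K ℤ.< j → j ∉ support u
  outside (ℤ.+ n) (ℤ.+<+ h) j∈ = ℕ.<⇒≱ h (All.lookup (All.map⁻ (xs≤max 0 (map ∣_∣ (support u)))) j∈)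

-- Descend from any word to a shorter one. Whether a shorter word exists is not decided here, hence
-- the double negation.
reduced-word-¬¬ : ∀ u → InSZ+ u → ¬ (∀ t → ¬ IsReducedWord u t)
reduced-word-¬¬ u low none with word-of u low
... | t , word = <-rec (λ n → ∀ t → length t ≡ n → ¬ IsWordOf u t)
  (λ { _ ih t refl word → none t (word , λ t′ word′ → ℕ.≮⇒≥ (λ h → ih h t′ refl word′)) }) (length t) t refl word

-- Increasing suffixes

last-∷ʳ : ∀ (xs : List ℤ) a → last (xs ++ a ∷ []) ≡ just a
last-∷ʳ []           a = refl
last-∷ʳ (_ ∷ [])     a = refl
last-∷ʳ (_ ∷ y ∷ xs) a = last-∷ʳ (y ∷ xs) a

Iᵢ-reverse : ∀ i a r → Iᵢ i (reverse (a ∷ r)) ≡ (if a ≤ᵇ i then decPrefix (a ∷ r) else 0)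
Iᵢ-reverse i a r with last (reverse (a ∷ r)) | trans (cong last (unfold-reverse a r)) (last-∷ʳ (reverse r) a)
... | _ | refl rewrite reverse-involutive (a ∷ r) = refl

IᵢSet-≥ : ∀ i {t X} → t ∈ X → Iᵢ i t ℕ.≤ IᵢSet i X
IᵢSet-≥ i {X = p ∷ X} (here refl) = ℕ.m≤m⊔n (Iᵢ i p) (IᵢSet i X)
IᵢSet-≥ i {X = p ∷ X} (there h)   = ℕ.≤-trans (IᵢSet-≥ i h) (ℕ.m≤n⊔m (Iᵢ i p) (IᵢSet i X))

IᵢSet-attained : ∀ i {t₀ X} → t₀ ∈ X → ∃ λ t → t ∈ X × Iᵢ i t ≡ IᵢSet i X
IᵢSet-attained i {X = p ∷ []}    _ = p , here refl , sym (ℕ.⊔-identityʳ (Iᵢ i p))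
IᵢSet-attained i {X = p ∷ q ∷ X} _ with ℕ.⊔-sel (Iᵢ i p) (IᵢSet i (q ∷ X)) | IᵢSet-attained i {X = q ∷ X} (here refl)
... | inj₁ e | _            = p , here refl , sym e
... | inj₂ e | t , t∈ , e′ = t , there t∈ , trans e′ (sym e)

-- Functionals of reduced words

δ-refl : ∀ t → δ t t ≡ 1ℤ
δ-refl []      = refl
δ-refl (a ∷ t) = trans (δ-head-≡ a t t) (δ-refl t)

δ-≢ : ∀ {t s} → t ≢ s → δ t s ≡ 0ℤ
δ-≢ {[]}    {[]}    h = ⊥-elim (h refl)
δ-≢ {[]}    {_ ∷ _} h = refl
δ-≢ {_ ∷ _} {[]}    h = refl
δ-≢ {a ∷ t} {b ∷ s} h with a ℕ.≟ b
... | yes refl = trans (δ-head-≡ a t s) (δ-≢ (h ∘ cong (a ∷_)))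
... | no ne    = δ-head-≢ t s ne

δ-nonneg : ∀ t s → 0ℤ ℤ.≤ δ t s
δ-nonneg t s with ≡-dec ℕ._≟_ t s
... | yes refl = subst (0ℤ ℤ.≤_) (sym (δ-refl t)) (ℤ.+≤+ z≤n)
... | no h     = subst (0ℤ ℤ.≤_) (sym (δ-≢ h)) ℤ.≤-refl

𝟙-nonneg : ∀ b → 0ℤ ℤ.≤ 𝟙 b
𝟙-nonneg true  = ℤ.+≤+ z≤n
𝟙-nonneg false = ℤ.≤-refl

≡ᵇ-true : ∀ {m n} → m ≡ n → (m ℕ.≡ᵇ n) ≡ true
≡ᵇ-true {m} {n} e = Equivalence.to T-≡ (ℕ.≡⇒≡ᵇ m n e)

≡ᵇ-false : ∀ {m n} → m ≢ n → (m ℕ.≡ᵇ n) ≡ false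
≡ᵇ-false {m} {n} h with m ℕ.≡ᵇ n in eq
... | true  = ⊥-elim (h (ℕ.≡ᵇ⇒≡ m n (Equivalence.from T-≡ eq)))
... | false = refl

Linked-≢ : ∀ t → (∀ p (a : ℕ) q → t ≢ p ++ a ∷ a ∷ q) → Linked _≢_ t
Linked-≢ []          h = []
Linked-≢ (a ∷ [])    h = [-]
Linked-≢ (a ∷ b ∷ t) h = (λ { refl → h [] a t refl }) ∷ Linked-≢ (b ∷ t) (λ p c q e → h (a ∷ p) c q (cong (a ∷_) e))

module _ (LO : ℕ) where

  private
    ι′ = ι LO

  -- Inverse to ι only on integers ≥ - LO.
  ν : ℤ → ℕ
  ν z = ∣ z + ℤ.+ LO ∣

  ν∘ι : ∀ n → ν (ι LO n) ≡ n
  ν∘ι n = cong ∣_∣ (ring (ℤ.+ n) (ℤ.+ LO))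
    where
    ring : ∀ a b → (a - b) + b ≡ a
    ring = solve-∀

  map-ν∘ι : ∀ s → map ν (map (ι LO) s) ≡ s
  map-ν∘ι s = trans (sym (map-∘ s)) (trans (map-cong ν∘ι s) (map-id s))

  InRange : ℤ → Set
  InRange a = ι LO (ν a) ≡ a

  map-ι∘ν : ∀ {t} → All InRange t → map (ι LO) (map ν t) ≡ t
  map-ι∘ν {t} h = trans (sym (map-∘ t)) (map-id-local h)

  decPrefix-≥ : ∀ {a d} q → Decreasing a d → suc (length d) ℕ.≤ decPrefix (ι LO a ∷ map (ι LO) d ++ q)
  decPrefix-≥ []      []      = ℕ.≤-refl
  decPrefix-≥ {a} (b ∷ q) [] with b <ᵇ ι LO a
  ... | true  = s≤s z≤n
  ... | false = ℕ.≤-refl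
  decPrefix-≥ q (h ∷ D) rewrite <ᵇ-true (ι-< LO h) = s≤s (decPrefix-≥ q D)

  decPrefix-split : ∀ a r → ∃₂ λ d e → r ≡ d ++ e × Decreasing a d × suc (length d) ≡ decPrefix (ι LO a ∷ map (ι LO) r)
  decPrefix-split a []      = [] , [] , refl , [] , refl
  decPrefix-split a (b ∷ r) with b ℕ.<? a
  ... | no b≮a rewrite <ᵇ-false (ι-≤ LO (ℕ.≮⇒≥ b≮a)) = [] , b ∷ r , refl , [] , refl
  ... | yes b<a rewrite <ᵇ-true (ι-< LO b<a) with decPrefix-split b r
  ...   | d , e , refl , D , l = b ∷ d , e , refl , b<a ∷ D , cong suc l

  module _ (i : ℤ) (i-range : InRange i) where

    ≤i-true : ∀ {a} → a ℕ.≤ ν i → (ι LO a ≤ᵇ i) ≡ true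
    ≤i-true h = ≤ᵇ-true (subst (ι LO _ ℤ.≤_) i-range (ι-≤ LO h))

    ≤i-false : ∀ {a} → ν i ℕ.< a → (ι LO a ≤ᵇ i) ≡ false
    ≤i-false h = ≤ᵇ-false (subst (ℤ._< ι LO _) i-range (ι-< LO h))

    Iᵢ-≥ : ∀ s d → Decreasing (suc (ν i)) d → length d ℕ.≤ Iᵢ i (map (ι LO) (s ++ (d ʳ++ [])))
    Iᵢ-≥ s []      D       = z≤n
    Iᵢ-≥ s (a ∷ d) (h ∷ D) = subst (suc (length d) ℕ.≤_) (sym (trans (cong (Iᵢ i) shape)
        (trans (Iᵢ-reverse i (ι LO a) (map (ι LO) d ++ reverse (map (ι LO) s)))
        (cong (λ b → if b then decPrefix (ι LO a ∷ map (ι LO) d ++ reverse (map (ι LO) s)) else 0) (≤i-true (ℕ.≤-pred h))))))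
      (decPrefix-≥ (reverse (map (ι LO) s)) D)
      where
      shape : map (ι LO) (s ++ reverse (a ∷ d)) ≡ reverse (map (ι LO) (a ∷ d) ++ reverse (map (ι LO) s))
      shape = trans (map-++ (ι LO) s (reverse (a ∷ d)))
        (sym (trans (reverse-++ (map (ι LO) (a ∷ d)) (reverse (map (ι LO) s)))
          (cong₂ _++_ (reverse-involutive (map (ι LO) s)) (sym (reverse-map (ι LO) (a ∷ d))))))

    -- If the last letter exceeds `i`, then `d` is empty, matching the default value 0 of `Iᵢ`.
    Iᵢ-attained : ∀ t → ∃₂ λ s d → t ≡ s ++ (d ʳ++ []) × Decreasing (suc (ν i)) d × length d ≡ Iᵢ i (map (ι LO) t)
    Iᵢ-attained t = subst P (reverse-involutive t) (go (reverse t))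
      where
      P : List ℕ → Set
      P t = ∃₂ λ s d → t ≡ s ++ (d ʳ++ []) × Decreasing (suc (ν i)) d × length d ≡ Iᵢ i (map (ι LO) t)
      go : ∀ r → P (reverse r)
      go []      = [] , [] , refl , [] , refl
      go (a ∷ r) rewrite reverse-map (ι LO) (a ∷ r) | Iᵢ-reverse i (ι LO a) (map (ι LO) r) with a ℕ.≤? ν i
      ... | no h rewrite ≤i-false (ℕ.≰⇒> h) = reverse (a ∷ r) , [] , sym (++-identityʳ (reverse (a ∷ r))) , [] , refl
      ... | yes h rewrite ≤i-true h with decPrefix-split a r
      ...   | d , e , refl , D , l = reverse e , a ∷ d , reverse-++ (a ∷ d) e , s≤s h ∷ D , l

  -- Indicator of the words of length n in a list without repetitions.
  occ : ℕ → List Word → Functional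
  occ n []       s = 0ℤ
  occ n (t ∷ ts) s = occ n ts s + 𝟙 (length t ℕ.≡ᵇ n) * δ (map ν t) s

  occ-nonneg : ∀ n ts s → 0ℤ ℤ.≤ occ n ts s
  occ-nonneg n []       s = ℤ.≤-refl
  occ-nonneg n (t ∷ ts) s = ℤ.+-mono-≤ (occ-nonneg n ts s) (*-nonneg (𝟙-nonneg (length t ℕ.≡ᵇ n)) (δ-nonneg (map ν t) s))

  +*-zero : ∀ {a} b {c} → a ≡ 0ℤ → c ≡ 0ℤ → a + b * c ≡ 0ℤ
  +*-zero b refl refl = trans (ℤ.+-identityˡ _) (ℤ.*-zeroʳ b)

  occ-∉ : ∀ n {ts} s → All (All InRange) ts → map (ι LO) s ∉ ts → occ n ts s ≡ 0ℤ
  occ-∉ n s []      h = refl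
  occ-∉ n {t ∷ ts} s (R ∷ Rs) h = +*-zero (𝟙 (length t ℕ.≡ᵇ n)) (occ-∉ n s Rs (h ∘ there))
    (δ-≢ (λ e → h (here (trans (cong (map (ι LO)) (sym e)) (map-ι∘ν R)))))

  occ-length : ∀ n ts s → length s ≢ n → occ n ts s ≡ 0ℤ
  occ-length n []       s h = refl
  occ-length n (t ∷ ts) s h with length t ℕ.≟ n
  ... | no ne rewrite ≡ᵇ-false ne = trans (cong (_+ 0ℤ * δ (map ν t) s) (occ-length n ts s h)) (trans (ℤ.+-identityˡ _) (ℤ.*-zeroˡ (δ (map ν t) s)))
  ... | yes e = +*-zero (𝟙 (length t ℕ.≡ᵇ n)) (occ-length n ts s h) (δ-≢ {map ν t} {s} (λ { refl → h (trans (length-map ν t) e) }))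

  occ-∈ : ∀ {ts} s → Unique ts → All (All InRange) ts → map (ι LO) s ∈ ts → occ (length s) ts s ≡ 1ℤ
  occ-∈ {t ∷ ts} s (t∉ ∷ U) (R ∷ Rs) (here refl)
    rewrite ≡ᵇ-true (length-map (ι LO) s) | map-ν∘ι s | δ-refl s =
    cong (_+ 1ℤ) (occ-∉ (length s) s Rs (λ h → All.lookup t∉ h refl))
  occ-∈ {t ∷ ts} s (t∉ ∷ U) (R ∷ Rs) (there h) =
    trans (cong₂ (λ p q → p + 𝟙 (length t ℕ.≡ᵇ length s) * q) (occ-∈ s U Rs h)
      (δ-≢ (λ e → All.lookup t∉ h (trans (sym (map-ι∘ν R)) (cong (map (ι LO)) e)))))
    (trans (cong (1ℤ +_) (ℤ.*-zeroʳ (𝟙 (length t ℕ.≡ᵇ length s)))) refl)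

  _∈?_ : ∀ (t : Word) ts → Dec (t ∈ ts)
  t ∈? ts = Any.any? (≡-dec ℤ._≟_ t) ts

  occ-cong : ∀ n {ts s s′} → Unique ts → All (All InRange) ts → length s ≡ length s′ →
    (map (ι LO) s ∈ ts → map (ι LO) s′ ∈ ts) → (map (ι LO) s′ ∈ ts → map (ι LO) s ∈ ts) → occ n ts s ≡ occ n ts s′
  occ-cong n {ts} {s} {s′} U R l to from with length s ℕ.≟ n
  ... | no h = trans (occ-length n ts s h) (sym (occ-length n ts s′ (h ∘ trans l)))
  ... | yes refl with map (ι LO) s ∈? ts
  ...   | no h  = trans (occ-∉ (length s) s R h) (sym (occ-∉ (length s) s′ R (h ∘ from)))
  ...   | yes h = trans (occ-∈ s U R h) (sym (subst (λ z → occ z ts s′ ≡ 1ℤ) (sym l) (occ-∈ s′ U R (to h))))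

  module _ (rw : Perm → List Word) where

    -- Its pairing with the Fomin-Stanley product is the degree `n` part of Σ c_w 𝔖_w; on a reduced
    -- word of length `n` it reads off the coefficient.
    combination : ℕ → List (Perm × ℤ) → Functional
    combination n []            s = 0ℤ
    combination n ((w , c) ∷ L) s = combination n L s + c * occ n (rw w) s

    AllInRange : List (Perm × ℤ) → Set
    AllInRange = All (λ wc → All (All InRange) (rw (proj₁ wc)))

    combination-zero : ∀ n {L} s → AllInRange L → All (λ wc → proj₂ wc ≢ 0ℤ → map (ι LO) s ∉ rw (proj₁ wc)) L →
      combination n L s ≡ 0ℤ
    combination-zero n s []       []       = refl
    combination-zero n {(w , c) ∷ L} s (R ∷ Rs) (h ∷ hs) with c ℤ.≟ 0ℤ
    ... | yes refl = trans (cong (_+ 0ℤ * occ n (rw w) s) (combination-zero n s Rs hs)) (trans (ℤ.+-identityˡ _) (ℤ.*-zeroˡ (occ n (rw w) s)))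
    ... | no c≢0 = +*-zero c (combination-zero n s Rs hs) (occ-∉ n s R (h c≢0))

    combination-length : ∀ n L s → length s ≢ n → combination n L s ≡ 0ℤ
    combination-length n []            s h = refl
    combination-length n ((w , c) ∷ L) s h = +*-zero c (combination-length n L s h) (occ-length n (rw w) s h)

  module _ (rw : Perm → List Word) (unique : ∀ w → Unique (rw w))
           (exact : ∀ w t → (t ∈ rw w → IsReducedWord w t) × (IsReducedWord w t → t ∈ rw w)) where

    -- A reduced word has no equal neighbours, and commutation and braid moves keep product and
    -- length, so they preserve RW(w).
    occ-nil : ∀ n w → All (All InRange) (rw w) → Nil (occ n (rw w))
    occ-nil n w R = record
      { square = λ p a q → occ-∉ n (p ++ a ∷ a ∷ q) R (λ h → reduced-no-square {w} (map ι′ p) (ι′ a) (map ι′ q)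
          (proj₁ (exact w _) (subst (_∈ rw w) (map-++ ι′ p (a ∷ a ∷ q)) h)))
      ; comm = λ p {a} {b} q h → transfer p {a ∷ b ∷ []} {b ∷ a ∷ []} q refl (s-comm (gap h))
      ; braid = λ p a q → transfer p {a ∷ suc a ∷ a ∷ []} {suc a ∷ a ∷ suc a ∷ []} q refl
          (subst (λ z → ∀ j → s (ι′ a) (s z (s (ι′ a) j)) ≡ s z (s (ι′ a) (s z j))) (sym (ι-suc a)) (s-braid (ι′ a)))
      }
      where
      ι-suc : ∀ a → ι′ (suc a) ≡ ι′ a + 1ℤ
      ι-suc a = trans (cong (_- ℤ.+ LO) (cong ℤ.+_ (ℕ.+-comm 1 a))) (ring (ℤ.+ a) (ℤ.+ LO))
        where
        ring : ∀ a b → (a + 1ℤ) - b ≡ (a - b) + 1ℤ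
        ring = solve-∀
      gap : ∀ {a b} → 2 ℕ.+ a ℕ.≤ b → ι′ a + 1ℤ ℤ.< ι′ b
      gap {a} {b} h = subst (ℤ._< ι′ b) (ι-suc a) (ι-< LO h)
      transfer : ∀ p {r r′} q → length r ≡ length r′ → (∀ j → prod (map ι′ r) j ≡ prod (map ι′ r′) j) →
        occ n (rw w) (p ++ r ++ q) ≡ occ n (rw w) (p ++ r′ ++ q)
      transfer p {r} {r′} q l e = occ-cong n (unique w) R (length-context p q l) (to l e) (to (sym l) (sym ∘ e))
        where
        split : ∀ r → map ι′ (p ++ r ++ q) ≡ map ι′ p ++ map ι′ r ++ map ι′ q
        split r = trans (map-++ ι′ p (r ++ q)) (cong (map ι′ p ++_) (map-++ ι′ r q))
        to : ∀ {r r′} → length r ≡ length r′ → (∀ j → prod (map ι′ r) j ≡ prod (map ι′ r′) j) →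
          map ι′ (p ++ r ++ q) ∈ rw w → map ι′ (p ++ r′ ++ q) ∈ rw w
        to {r} {r′} l e h = subst (_∈ rw w) (sym (split r′)) (proj₂ (exact w _)
          (reduced-context {w} (map ι′ p) (map ι′ q) e (trans (length-map ι′ r) (trans l (sym (length-map ι′ r′))))
            (proj₁ (exact w _) (subst (_∈ rw w) (split r) h))))

    combination-nil : ∀ n {L} → AllInRange rw L → Nil (combination rw n L)
    combination-nil n []      = record { square = λ _ _ _ → refl ; comm = λ _ _ _ → refl ; braid = λ _ _ _ → refl }
    combination-nil n {(w , c) ∷ L} (R ∷ Rs) = record
      { square = λ p a q → +*-zero c (square N p a q) (square O p a q)
      ; comm   = λ p q h → cong₂ (λ y z → y + c * z) (comm N p q h) (comm O p q h)
      ; braid  = λ p a q → cong₂ (λ y z → y + c * z) (braid N p a q) (braid O p a q)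
      }
      where
      N = combination-nil n Rs
      O = occ-nil n w R

    -- A word determines its permutation, so by distinctness only one entry of `L` has `s` among its
    -- reduced words.
    combination-∈ : ∀ {L wc} s → AllPairs (λ p q → ¬ (proj₁ p ≈ₚ proj₁ q)) L → AllInRange rw L → wc ∈ L →
      map ι′ s ∈ rw (proj₁ wc) → combination rw (length s) L s ≡ proj₂ wc
    combination-∈ {(w , c) ∷ L} s (ds ∷ _) (R ∷ Rs) (here refl) h =
      trans (cong₂ (λ y z → y + c * z) (combination-zero rw (length s) s Rs (All.map (λ d _ h′ → d (same h h′)) ds)) (occ-∈ s (unique w) R h))
        (trans (ℤ.+-identityˡ _) (ℤ.*-identityʳ c))
      where
      same : ∀ {w w′ t} → t ∈ rw w → t ∈ rw w′ → w ≈ₚ w′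
      same h h′ j = trans (sym (proj₁ (proj₁ (exact _ _) h) j)) (proj₁ (proj₁ (exact _ _) h′) j)
    combination-∈ {(w , c) ∷ L} {wc} s (ds ∷ D) (R ∷ Rs) (there wc∈) h =
      trans (cong₂ (λ y z → y + c * z) (combination-∈ s D Rs wc∈ h)
        (occ-∉ (length s) s R (λ h′ → All.lookup ds wc∈ (λ j → trans (sym (proj₁ (proj₁ (exact _ _) h′) j)) (proj₁ (proj₁ (exact _ _) h) j)))))
        (trans (cong (λ z → proj₂ wc + z) (ℤ.*-zeroʳ c)) (ℤ.+-identityʳ (proj₂ wc)))

    module _ (x : ℕ → ℤ) (K : ℕ) where

      -- Reduced words have no equal neighbours, so `Ms-bot` applies in degree length t; in other
      -- degrees there are no bottom rows.
      Ms-word : ∀ n {w t} → t ∈ rw w → All InRange t → All (λ a → ν a ℕ.< K) t →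
        Ms LO x K 0 n (λ m → 𝟙 (isBottom t m)) ≡ 𝟙 (length t ℕ.≡ᵇ n) * Sch K 0 x (δ (map ν t)) []
      Ms-word n {w} {t} t∈ R h with length t ℕ.≟ n
      ... | no ne rewrite ≡ᵇ-false ne = trans (Ms-zero LO x K 0 n (λ m _ l → cong 𝟙 (isBottom-length t m (λ e → ne (trans (sym e) l)))))
              (sym (ℤ.*-zeroˡ (Sch K 0 x (δ (map ν t)) [])))
      ... | yes refl rewrite ≡ᵇ-true (refl {x = length t}) =
        trans (Ms-cong LO x K 0 (length t) (λ m _ _ → cong (λ z → 𝟙 (isBottom z m)) (sym (map-ι∘ν R))))
        (trans (cong (λ z → Ms LO x K 0 z (bot LO x (map ν t))) (sym (length-map ν t)))
        (trans (Ms-bot LO x K 0 (map ν t) (Linked-≢ (map ν t) no-square)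
           (All.map⁺ (All.map (λ {a} → subst (ν a ℕ.<_) (sym (ℕ.+-identityʳ K))) h)))
          (sym (ℤ.*-identityˡ _))))
        where
        no-square : ∀ p a q → map ν t ≢ p ++ a ∷ a ∷ q
        no-square p a q e = reduced-no-square {w} (map ι′ p) (ι′ a) (map ι′ q)
          (subst (IsReducedWord w) (trans (sym (map-ι∘ν R)) (trans (cong (map ι′) e) (map-++ ι′ p (a ∷ a ∷ q)))) (proj₁ (exact w t) t∈))

      Ms-coeffS : ∀ n w → All (All InRange) (rw w) → All (All (λ a → ν a ℕ.< K)) (rw w) →
        Ms LO x K 0 n (λ m → ℤ.+ coeffS rw w m) ≡ Sch K 0 x (occ n (rw w)) []
      Ms-coeffS n w R h = go (rw w) (λ t∈ → t∈) R h
        where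
        go : ∀ ts → (∀ {t} → t ∈ ts → t ∈ rw w) → All (All InRange) ts → All (All (λ a → ν a ℕ.< K)) ts →
          Ms LO x K 0 n (λ m → ℤ.+ length (filterᵇ (λ t → isBottom t m) ts)) ≡ Sch K 0 x (occ n ts) []
        go [] sub [] [] = trans (Ms-zero LO x K 0 n (λ _ _ _ → refl)) (sym (Sch-zero K 0 x []))
        go (t ∷ ts) sub (R ∷ Rs) (h ∷ hs) =
          trans (Ms-cong LO x K 0 n (λ m _ _ → count m))
          (trans (Ms-linear LO x K 0 n _ 1ℤ _)
          (trans (cong₂ (λ p q → p + 1ℤ * q) (go ts (sub ∘ there) Rs hs) (Ms-word n (sub (here refl)) R h))
          (trans (cong (Sch K 0 x (occ n ts) [] +_) (ℤ.*-identityˡ _))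
          (sym (Sch-linear K 0 x (occ n ts) (𝟙 (length t ℕ.≡ᵇ n)) (δ (map ν t)) [])))))
          where
          count : ∀ m → ℤ.+ length (filterᵇ (λ t → isBottom t m) (t ∷ ts))
            ≡ ℤ.+ length (filterᵇ (λ t → isBottom t m) ts) + 1ℤ * 𝟙 (isBottom t m)
          count m with isBottom t m
          ... | true  = cong ℤ.+_ (ℕ.+-comm 1 (length (filterᵇ (λ t → isBottom t m) ts)))
          ... | false = sym (ℤ.+-identityʳ _)

      Ms-linCoeff : ∀ n {L} → AllInRange rw L → All (λ wc → All (All (λ a → ν a ℕ.< K)) (rw (proj₁ wc))) L →
        Ms LO x K 0 n (linCoeff rw L) ≡ Sch K 0 x (combination rw n L) []
      Ms-linCoeff n [] [] = trans (Ms-zero LO x K 0 n (λ _ _ _ → refl)) (sym (Sch-zero K 0 x []))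
      Ms-linCoeff n {(w , c) ∷ L} (R ∷ Rs) (h ∷ hs) =
        trans (Ms-cong LO x K 0 n (λ m _ _ → ℤ.+-comm (c * ℤ.+ coeffS rw w m) (linCoeff rw L m)))
        (trans (Ms-linear LO x K 0 n (linCoeff rw L) c _)
        (trans (cong₂ (λ p q → p + c * q) (Ms-linCoeff n Rs hs) (Ms-coeffS n w R h))
        (sym (Sch-linear K 0 x (combination rw n L) c (occ n (rw w)) []))))

-- The theorem

x₀ : ℕ → ℤ
x₀ j = ℤ.+ suc j

x₀-good : Good x₀
injective x₀-good refl = refl
positive  x₀-good j    = ℤ.+<+ (s≤s z≤n)

opaque
  unfolding _⊗_

  ⊗-at : ∀ f g x → (f ⊗ g) x ≡ f x * g x
  ⊗-at f g x = refl

IᵢSet-nonempty : ∀ i X → 0 ℕ.< IᵢSet i X → ∃ (_∈ X)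
IᵢSet-nonempty i (t ∷ X) h = t , here refl

module Core
  (rw : Perm → List Word) (unique : ∀ w → Unique (rw w))
  (exact : ∀ w t → (t ∈ rw w → IsReducedWord w t) × (IsReducedWord w t → t ∈ rw w))
  (i : ℤ) (LO K l : ℕ) (l<K : l ℕ.< K) (i-range : InRange LO i) (k<K : suc (ν LO i) ℕ.< K)
  where

  private
    ι′ = ι LO
    ν′ = ν LO
    -- The shifted letters below `k` are those ≤ i.
    k = suc (ν LO i)

  Admissible : ℤ → Set
  Admissible a = InRange LO a × l ℕ.≤ ν LO a × suc (ν LO a) ℕ.< K

  AdmissibleWords : Perm → Set
  AdmissibleWords w = All (All Admissible) (rw w)

  𝕏 : ℕ → List (Perm × ℤ) → Functional
  𝕏 = combination LO rw

  𝔖 : ℕ → List (Perm × ℤ) → List ℕ → Fun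
  𝔖 n L = ⟦_⟧ K (𝕏 n L)

  module Side {L : List (Perm × ℤ)} (adm : All (AdmissibleWords ∘ proj₁) L) where

    range : AllInRange LO rw L
    range = All.map (All.map (All.map proj₁)) adm

    below : All (λ wc → All (All (λ a → ν LO a ℕ.< K)) (rw (proj₁ wc))) L
    below = All.map (All.map (All.map (λ (_ , _ , h) → ℕ.<-trans (ℕ.n<1+n _) h))) adm

    nil : ∀ n → Nil (𝕏 n L)
    nil n = combination-nil LO rw unique exact n range

    low : ∀ n → Low K (nil n) l
    low n p {a} q a<l = combination-zero LO rw n (p ++ a ∷ q) range
      (All.map (λ A _ h → absurd (All.lookup A h)) adm)
      where
      absurd : ¬ All Admissible (map ι′ (p ++ a ∷ q))
      absurd A with All.++⁻ʳ (map ι′ p) (subst (All Admissible) (map-++ ι′ p (a ∷ q)) A)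
      ... | (_ , l≤ , _) ∷ _ = ℕ.<⇒≱ a<l (subst (l ℕ.≤_) (ν∘ι LO a) l≤)

    vanishing : ∀ n {P} → All (λ wc → proj₂ wc ≢ 0ℤ → IᵢSet i (rw (proj₁ wc)) ℕ.< P) L →
      ∀ d → Decreasing k d → P ℕ.≤ length d → ∀ s → 𝕏 n L (s ++ (d ʳ++ [])) ≡ 0ℤ
    vanishing n bound d D len s = combination-zero LO rw n (s ++ (d ʳ++ [])) range
      (All.map (λ b c≢0 h → ℕ.<⇒≱ (b c≢0) (ℕ.≤-trans len (ℕ.≤-trans (Iᵢ-≥ LO i i-range s d D) (IᵢSet-≥ i h)))) bound)

    lc : ∀ n m e P → P ℕ.+ m ℕ.≤ suc l → suc k ≡ e ℕ.+ P ℕ.+ m →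
      All (λ wc → proj₂ wc ≢ 0ℤ → IᵢSet i (rw (proj₁ wc)) ℕ.< P) L →
      LC m e P (𝔖 n L []) (leading K (nil n) m e P [])
    lc n m e P h eq bound = LC-leading K (nil n) m e P [] l<K (low n) h eq k<K (vanishing n bound)

  module Theorem
    (u v : Perm) (adm-u : AdmissibleWords u) (adm-v : AdmissibleWords v)
    (tᵤ tᵥ : Word) (tᵤ∈ : tᵤ ∈ rw u) (tᵥ∈ : tᵥ ∈ rw v)
    (len-u : All (λ t → length t ℕ.≤ l) (rw u)) (len-v : All (λ t → length t ℕ.≤ l) (rw v))
    (L : List (Perm × ℤ)) (distinct : AllPairs (λ p q → ¬ (proj₁ p ≈ₚ proj₁ q)) L)
    (expansion : ∀ m → Linked ℤ._≤_ m → ℤ.+ prodCoeff (coeffS rw u) (coeffS rw v) m ≡ linCoeff rw L m)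
    (adm : All (AdmissibleWords ∘ proj₁) L)
    (p+q≤l : IᵢSet i (rw u) ℕ.+ IᵢSet i (rw v) ℕ.≤ l) (p+q≤k : IᵢSet i (rw u) ℕ.+ IᵢSet i (rw v) ℕ.≤ k)
    where

    p q e : ℕ
    p = IᵢSet i (rw u)
    q = IᵢSet i (rw v)
    -- Chosen so that `LC 0 e (suc (p + q))` concerns exactly the letters below `k`.
    e = k ∸ (p ℕ.+ q)

    ℓ : ℕ
    ℓ = length tᵤ ℕ.+ length tᵥ

    one : Perm → List (Perm × ℤ)
    one w = (w , 1ℤ) ∷ []

    module U = Side {one u} (adm-u ∷ [])
    module V = Side {one v} (adm-v ∷ [])
    module R = Side {L} adm

    fᵤ fᵥ : Fun
    fᵤ = 𝔖 (length tᵤ) (one u) []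
    fᵥ = 𝔖 (length tᵥ) (one v) []

    k-split : k ≡ e ℕ.+ (p ℕ.+ q)
    k-split = sym (ℕ.m∸n+n≡m p+q≤k)

    k-eq : suc k ≡ e ℕ.+ suc (p ℕ.+ q) ℕ.+ 0
    k-eq = trans (cong suc k-split) (ring e (p ℕ.+ q))
      where
      ring : ∀ e r → suc (e ℕ.+ r) ≡ e ℕ.+ suc r ℕ.+ 0
      ring = ℕ-Ring.solve-∀

    boundᵤ : suc p ℕ.+ (q ℕ.+ 0) ℕ.≤ suc l
    boundᵤ = s≤s (subst (ℕ._≤ l) (cong (p ℕ.+_) (sym (ℕ.+-identityʳ q))) p+q≤l)

    boundᵥ : suc q ℕ.+ (p ℕ.+ 0) ℕ.≤ suc l
    boundᵥ = s≤s (subst (ℕ._≤ l) (trans (ℕ.+-comm p q) (cong (q ℕ.+_) (sym (ℕ.+-identityʳ p)))) p+q≤l)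

    indexᵤ : suc k ≡ e ℕ.+ suc p ℕ.+ (q ℕ.+ 0)
    indexᵤ = trans (cong suc k-split) (ring e p q)
      where
      ring : ∀ e p q → suc (e ℕ.+ (p ℕ.+ q)) ≡ e ℕ.+ suc p ℕ.+ (q ℕ.+ 0)
      ring = ℕ-Ring.solve-∀

    indexᵥ : suc k ≡ e ℕ.+ suc q ℕ.+ (p ℕ.+ 0)
    indexᵥ = trans (cong suc k-split) (ring e p q)
      where
      ring : ∀ e p q → suc (e ℕ.+ (p ℕ.+ q)) ≡ e ℕ.+ suc q ℕ.+ (p ℕ.+ 0)
      ring = ℕ-Ring.solve-∀

    cᵤ cᵥ : Fun
    cᵤ = leading K (U.nil (length tᵤ)) (q ℕ.+ 0) e (suc p) []
    cᵥ = leading K (V.nil (length tᵥ)) (p ℕ.+ 0) e (suc q) []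

    lc-product : LC 0 e (suc (p ℕ.+ q)) (fᵤ ⊗ fᵥ) (cᵤ ⊗ cᵥ)
    lc-product = LC-mul 0 e p q
      (U.lc (length tᵤ) (q ℕ.+ 0) e (suc p) boundᵤ indexᵤ ((λ _ → ℕ.n<1+n p) ∷ []))
      (V.lc (length tᵥ) (p ℕ.+ 0) e (suc q) boundᵥ indexᵥ ((λ _ → ℕ.n<1+n q) ∷ []))

    coeffS-graded : ∀ {w t} → t ∈ rw w → Graded (length t) (coeffS rw w)
    coeffS-graded {w} {t} t∈ m ne = go (rw w) (λ h → h)
      where
      go : ∀ ts → (∀ {t′} → t′ ∈ ts → t′ ∈ rw w) → length (filterᵇ (λ t → isBottom t m) ts) ≡ 0
      go []        sub = refl
      go (t′ ∷ ts) sub rewrite isBottom-length t′ m (λ e → ne (trans e (reduced-same-length w t′ t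
        (proj₁ (exact w t′) (sub (here refl))) (proj₁ (exact w t) t∈)))) = go ts (sub ∘ there)

    single : ∀ x n w → (adm-w : AdmissibleWords w) →
      Ms LO x K 0 n (ℤ.+_ ∘ coeffS rw w) ≡ 𝔖 n (one w) [] x
    single x n w adm-w =
      trans (Ms-cong LO x K 0 n (λ m _ _ → sym (trans (ℤ.+-identityʳ _) (ℤ.*-identityˡ _))))
        (Ms-linCoeff LO rw unique exact x K n {one w} (Side.range (adm-w ∷ [])) (Side.below (adm-w ∷ [])))

    total-sum : ∀ n x → Ms LO x K 0 n (ℤ.+_ ∘ prodCoeff (coeffS rw u) (coeffS rw v)) ≡ 𝔖 n L [] x
    total-sum n x = trans (Ms-cong LO x K 0 n (λ m F _ → expansion m (From-sorted LO F)))
      (Ms-linCoeff LO rw unique exact x K n R.range R.below)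

    product≈ : fᵤ ⊗ fᵥ ≈ 𝔖 ℓ L []
    at product≈ x G = trans (⊗-at fᵤ fᵥ x)
      (trans (cong₂ _*_ (sym (single x (length tᵤ) u adm-u)) (sym (single x (length tᵥ) v adm-v)))
      (trans (sym (Ms-product LO x K 0 (length tᵤ) (length tᵥ) (coeffS rw u) (coeffS rw v) (coeffS-graded tᵤ∈) (coeffS-graded tᵥ∈)))
        (total-sum ℓ x)))

    other≈ : ∀ n → n ≢ ℓ → 𝔖 n L [] ≈ 𝟎
    at (other≈ n ne) x G = trans (sym (total-sum n x)) (Ms-zero LO x K 0 n
      (λ m _ len → cong ℤ.+_ (prodCoeff-graded (coeffS-graded tᵤ∈) (coeffS-graded tᵥ∈) m (λ h → ne (trans (sym len) h)))))

    -- `L` may list permutations of any length; comparing degrees in the expansion, the parts of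
    -- degree other than `ℓ` vanish.
    lc-right : ∀ n → ∃ λ c → LC 0 e (suc (p ℕ.+ q)) (𝔖 n L []) c
    lc-right n with n ℕ.≟ ℓ
    ... | yes refl = _ , LC-resp product≈ ≈-refl lc-product
    ... | no ne    = 𝟎 , LC-≈zero (other≈ n ne) ≈-refl

    upper : ∀ {wc} → wc ∈ L → proj₂ wc ≢ 0ℤ → IᵢSet i (rw (proj₁ wc)) ℕ.≤ p ℕ.+ q
    upper {w , c} wc∈ c≢0 = ℕ.≮⇒≥ contradiction
      where
      contradiction : ¬ (p ℕ.+ q ℕ.< IᵢSet i (rw w))
      contradiction h with IᵢSet-nonempty i (rw w) (ℕ.≤-trans (s≤s z≤n) h)
      ... | _ , t₀∈ with IᵢSet-attained i t₀∈
      ... | t , t∈ , I≡ with Iᵢ-attained LO i i-range (map ν′ t)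
      ... | s , d , t≡ , D , len = c≢0 (trans (sym value) zero-value)
        where
        A : All Admissible t
        A = All.lookup (All.lookup adm wc∈) t∈
        ι∘ν : map ι′ (map ν′ t) ≡ t
        ι∘ν = map-ι∘ν LO (All.map proj₁ A)
        t̂ = s ++ (d ʳ++ [])
        n = length t̂
        t̂∈ : map ι′ t̂ ∈ rw w
        t̂∈ = subst (_∈ rw w) (trans (sym ι∘ν) (cong (map ι′) t≡)) t∈
        long : suc (p ℕ.+ q) ℕ.≤ length d
        long = subst (suc (p ℕ.+ q) ℕ.≤_) (sym (trans len (trans (cong (Iᵢ i) ι∘ν) I≡))) h
        killed : 𝔖 n L (d ʳ++ []) ≈ 𝟎
        killed = LC-kills K (R.nil n) [] (proj₂ (lc-right n)) ≈-refl k-eq k<K D long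
        s-letters : All (λ a → suc a ℕ.< K) s
        s-letters = All.++⁻ˡ s (subst (All (λ a → suc a ℕ.< K)) t≡ (All.map⁺ (All.map (proj₂ ∘ proj₂) A)))
        -- The divided differences along the other letters `s` keep the function zero.
        killed′ : 𝔖 n L t̂ ≈ 𝟎
        killed′ = subst (λ z → 𝔖 n L z ≈ 𝟎) (trans (ʳ++-defn (reverse s)) (cong (_++ (d ʳ++ [])) (reverse-involutive s)))
          (⟦⟧-ʳ++-zero K (R.nil n) (reverse s) (d ʳ++ []) (All.tabulate (λ h → All.lookup s-letters (Any.reverse⁻ h))) killed)
        value : 𝕏 n L t̂ ≡ c
        value = combination-∈ LO rw unique exact t̂ distinct R.range wc∈ t̂∈
        -- Words properly extending `t̂` have length different from `n`, so by `Sch-top` the divided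
        -- difference is the constant 𝕏 n L t̂.
        zero-value : 𝕏 n L t̂ ≡ 0ℤ
        zero-value = trans (sym (Sch-top K 0 x₀ t̂ (λ a s′ → combination-length LO rw n L (a ∷ s′ ++ t̂)
            (λ h → ℕ.<⇒≢ (ℕ.≤-<-trans (ℕ.m≤n+m n (length s′)) (ℕ.n<1+n _)) (sym (trans (cong suc (sym (length-++ s′))) h))))))
          (at killed′ x₀ x₀-good)

    -- A reduced word attaining the maximum contributes coefficient 1, and its prefix `s` has length
    -- ≤ l, hence no longer than any of its letters is large, as `Sch-pos` requires.
    top-pos : ∀ {w t} m P → (adm-w : AdmissibleWords w) → t ∈ rw w → All (λ t → length t ℕ.≤ l) (rw w) →
      P ≡ suc (IᵢSet i (rw w)) → P ℕ.+ m ℕ.≤ suc l → suc k ≡ e ℕ.+ P ℕ.+ m →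
      0ℤ ℤ.< leading K (Side.nil {one w} (adm-w ∷ []) (length t)) m e P [] x₀
    top-pos {w} {t₀} m P adm-w t₀∈ short P≡ bound eq with IᵢSet-attained i t₀∈
    ... | t , t∈ , I≡ with Iᵢ-attained LO i i-range (map ν′ t)
    ... | s , d , t≡ , D , len = leading-pos K W.nil′ nonneg m e P [] d s x₀-good (W.low (length t₀)) bound eq D
        (trans P≡ (cong suc (sym (trans len (trans (cong (Iᵢ i) ι∘ν) I≡)))))
        (All.++⁻ˡ s (subst (All (λ a → length s ℕ.≤ a × a ℕ.< K)) t≡ (All.map⁺ (All.map bounds A))))
        (subst (0ℤ ℤ.<_) (sym value) (ℤ.+<+ (s≤s z≤n)))
      where
      module W where
        open Side {one w} (adm-w ∷ []) public
        nil′ = nil (length t₀)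
      nonneg : Nonnegative (𝕏 (length t₀) (one w))
      nonneg s = subst (0ℤ ℤ.≤_) (sym (trans (ℤ.+-identityˡ _) (ℤ.*-identityˡ _))) (occ-nonneg LO (length t₀) (rw w) s)
      A : All Admissible t
      A = All.lookup adm-w t∈
      ι∘ν : map ι′ (map ν′ t) ≡ t
      ι∘ν = map-ι∘ν LO (All.map proj₁ A)
      t̂ = s ++ (d ʳ++ [])
      length-t̂ : length t̂ ≡ length t
      length-t̂ = trans (cong length (sym t≡)) (length-map ν′ t)
      bounds : ∀ {a} → Admissible a → length s ℕ.≤ ν′ a × ν′ a ℕ.< K
      bounds (_ , l≤ , h) = ℕ.≤-trans (ℕ.≤-trans (subst (length s ℕ.≤_) (trans (sym (length-++ s)) length-t̂) (ℕ.m≤m+n (length s) _))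
        (All.lookup short t∈)) l≤ , ℕ.<-trans (ℕ.n<1+n _) h
      value : 𝕏 (length t₀) (one w) t̂ ≡ 1ℤ
      value = subst (λ z → 𝕏 z (one w) t̂ ≡ 1ℤ) (trans length-t̂ (reduced-same-length w t t₀ (proj₁ (exact w t) t∈) (proj₁ (exact w t₀) t₀∈)))
        (combination-∈ LO rw unique exact t̂ ([] ∷ []) W.range (here refl) (subst (_∈ rw w) (trans (sym ι∘ν) (cong (map ι′) t≡)) t∈))

    attained : Any (λ wc → (proj₂ wc ≢ 0ℤ) × (IᵢSet i (rw (proj₁ wc)) ≡ p ℕ.+ q)) L
    attained with Any.any? (λ wc → ¬? (proj₂ wc ℤ.≟ 0ℤ) ×-dec (IᵢSet i (rw (proj₁ wc)) ℕ.≟ p ℕ.+ q)) L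
    ... | yes h = h
    ... | no h = ⊥-elim (ℤ.<⇒≢ positive-top (sym zero-top))
      where
      strict : All (λ wc → proj₂ wc ≢ 0ℤ → IᵢSet i (rw (proj₁ wc)) ℕ.< p ℕ.+ q) L
      strict = All.tabulate (λ wc∈ c≢0 → ℕ.≤∧≢⇒< (upper wc∈ c≢0) (λ e → All.lookup (All.¬Any⇒All¬ L h) wc∈ (c≢0 , e)))
      -- The leading coefficient computed from `L`; by `LC-unique` it equals cᵤ cᵥ, and `strict`
      -- makes it zero.
      lc-sum = R.lc ℓ 0 e (suc (p ℕ.+ q)) (subst (ℕ._≤ suc l) (sym (ℕ.+-identityʳ (suc (p ℕ.+ q)))) (s≤s p+q≤l)) k-eq
        (All.map (λ b c≢0 → ℕ.<-trans (b c≢0) (ℕ.n<1+n _)) strict)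
      zero-top : cᵤ x₀ * cᵥ x₀ ≡ 0ℤ
      zero-top = trans (sym (⊗-at cᵤ cᵥ x₀)) (at (≈-trans (LC-unique product≈ lc-product lc-sum)
        (leading-zero K (R.nil ℓ) 0 e (p ℕ.+ q) [] k-eq (R.vanishing ℓ strict))) x₀ x₀-good)
      positive-top : 0ℤ ℤ.< cᵤ x₀ * cᵥ x₀
      positive-top = *-pos (top-pos (q ℕ.+ 0) (suc p) adm-u tᵤ∈ len-u refl boundᵤ indexᵤ)
                           (top-pos (p ℕ.+ 0) (suc q) adm-v tᵥ∈ len-v refl boundᵥ indexᵥ)

-- Choice of the truncation

decPrefix-≤ : ∀ r → decPrefix r ℕ.≤ length r
decPrefix-≤ []          = z≤n
decPrefix-≤ (a ∷ [])    = ℕ.≤-refl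
decPrefix-≤ (a ∷ b ∷ r) with b <ᵇ a | decPrefix-≤ (b ∷ r)
... | true  | ih = s≤s ih
... | false | _  = s≤s z≤n

Iᵢ-≤ : ∀ i t → Iᵢ i t ℕ.≤ length t
Iᵢ-≤ i t with last t
... | nothing = z≤n
... | just a with a ≤ᵇ i
...   | true  = subst (I t ℕ.≤_) (length-reverse t) (decPrefix-≤ (reverse t))
...   | false = z≤n

IᵢSet-≤ : ∀ i {n X} → All (λ t → length t ℕ.≤ n) X → IᵢSet i X ℕ.≤ n
IᵢSet-≤ i []                = z≤n
IᵢSet-≤ i {X = t ∷ X} (h ∷ hs) = ℕ.⊔-lub (ℕ.≤-trans (Iᵢ-≤ i t) h) (IᵢSet-≤ i hs)

∈⇒≤sum : ∀ {A : Set} (f : A → ℕ) {y ys} → y ∈ ys → f y ℕ.≤ sum (map f ys)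
∈⇒≤sum f (here refl) = ℕ.m≤m+n _ _
∈⇒≤sum f (there h)   = ℕ.≤-trans (∈⇒≤sum f h) (ℕ.m≤n+m _ _)

shift-bounded : ∀ B a → ∣ a ∣ ℕ.≤ B → ∃ λ n → a + ℤ.+ (B ℕ.+ (B ℕ.+ B)) ≡ ℤ.+ n × B ℕ.+ B ℕ.≤ n × n ℕ.≤ B ℕ.+ B ℕ.+ (B ℕ.+ B)
shift-bounded B (ℤ.+ m) h = m ℕ.+ (B ℕ.+ (B ℕ.+ B)) , refl , ℕ.≤-trans (ℕ.m≤n+m (B ℕ.+ B) B) (ℕ.m≤n+m _ m) ,
  subst (m ℕ.+ (B ℕ.+ (B ℕ.+ B)) ℕ.≤_) (sym (ℕ.+-assoc B B (B ℕ.+ B))) (ℕ.+-monoˡ-≤ (B ℕ.+ (B ℕ.+ B)) h)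
shift-bounded B ℤ.-[1+ m ] h = B ℕ.+ (B ℕ.+ B) ∸ suc m , ℤ.⊖-≥ (ℕ.≤-trans h (ℕ.m≤m+n B (B ℕ.+ B))) ,
  subst (B ℕ.+ B ℕ.≤_) (sym (ℕ.+-∸-comm (B ℕ.+ B) h)) (ℕ.m≤n+m (B ℕ.+ B) (B ∸ suc m)) ,
  ℕ.≤-trans (ℕ.m∸n≤m (B ℕ.+ (B ℕ.+ B)) (suc m)) (subst (B ℕ.+ (B ℕ.+ B) ℕ.≤_) (sym (ℕ.+-assoc B B (B ℕ.+ B))) (ℕ.m≤n+m _ B))

theorem5p10 : (rw : Perm → List Word) →
    (∀ w → Unique (rw w)) →
    (∀ w t → (t ∈ rw w → IsReducedWord w t) × (IsReducedWord w t → t ∈ rw w)) →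
    (u v : Perm) → InSZ+ u → InSZ+ v →
    (L : List (Perm × ℤ)) →
    AllPairs (λ p q → ¬ (proj₁ p ≈ₚ proj₁ q)) L →
    (∀ m → Linked ℤ._≤_ m → ℤ.+ prodCoeff (coeffS rw u) (coeffS rw v) m ≡ linCoeff rw L m) →
    (i : ℤ) →
    All (λ wc → proj₂ wc ≢ 0ℤ → IᵢSet i (rw (proj₁ wc)) ℕ.≤ IᵢSet i (rw u) ℕ.+ IᵢSet i (rw v)) L
    × Any (λ wc → (proj₂ wc ≢ 0ℤ) × (IᵢSet i (rw (proj₁ wc)) ≡ IᵢSet i (rw u) ℕ.+ IᵢSet i (rw v))) L
theorem5p10 rw unique exact u v u∈S v∈S L distinct expansion i = All.tabulate upper , attained
  where
  size : Word → ℕ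
  size t = length t ℕ.+ sum (map ∣_∣ t)

  words : List Word
  words = rw u ++ rw v ++ concatMap (rw ∘ proj₁) L

  B LO l K : ℕ
  -- One bound for |i| and for all lengths and letters involved. The shift by 3B moves [-B, B] to
  -- [2B, 4B], which leaves l = 2B letters free below: enough for p + q ≤ 2B and for prefixes of
  -- length ≤ B.
  B  = ∣ i ∣ ℕ.+ sum (map size words)
  LO = B ℕ.+ (B ℕ.+ B)
  l  = B ℕ.+ B
  K  = 3 ℕ.+ (B ℕ.+ B ℕ.+ (B ℕ.+ B))

  l<K : l ℕ.< K
  l<K = s≤s (ℕ.≤-trans (ℕ.m≤m+n l l) (ℕ.m≤n+m _ 2))

  letter : ∀ {a} → ∣ a ∣ ℕ.≤ B → InRange LO a × l ℕ.≤ ν LO a × suc (suc (ν LO a)) ℕ.< K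
  letter {a} h with shift-bounded B a h
  ... | n , e , l≤ , ≤K rewrite cong ∣_∣ e =
    trans (cong (_- ℤ.+ LO) (sym e)) (ring a (ℤ.+ LO)) , l≤ , s≤s (s≤s (s≤s ≤K))
    where
    ring : ∀ a b → (a + b) - b ≡ a
    ring = solve-∀

  i-bounds = letter {i} (ℕ.m≤m+n ∣ i ∣ _)

  open Core rw unique exact i LO K l l<K (proj₁ i-bounds) (ℕ.<-trans (ℕ.n<1+n _) (proj₂ (proj₂ i-bounds)))

  module _ {w : Perm} (sub : ∀ {t} → t ∈ rw w → t ∈ words) where

    size≤B : ∀ {t} → t ∈ rw w → size t ℕ.≤ B
    size≤B h = ℕ.≤-trans (∈⇒≤sum size (sub h)) (ℕ.m≤n+m _ ∣ i ∣)

    admissible : AdmissibleWords w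
    admissible = All.tabulate (λ {t} t∈ → All.tabulate (λ a∈ →
      let r , l≤ , <K = letter (ℕ.≤-trans (∈⇒≤sum ∣_∣ a∈) (ℕ.≤-trans (ℕ.m≤n+m _ (length t)) (size≤B t∈)))
      in r , l≤ , ℕ.<-trans (ℕ.n<1+n _) <K))

    short : All (λ t → length t ℕ.≤ B) (rw w)
    short = All.tabulate (λ t∈ → ℕ.≤-trans (ℕ.m≤m+n _ _) (size≤B t∈))

  sub-u : ∀ {t} → t ∈ rw u → t ∈ words
  sub-u = ∈-++⁺ˡ
  sub-v : ∀ {t} → t ∈ rw v → t ∈ words
  sub-v = ∈-++⁺ʳ (rw u) ∘ ∈-++⁺ˡ
  sub-L : ∀ {wc} → wc ∈ L → ∀ {t} → t ∈ rw (proj₁ wc) → t ∈ words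
  sub-L wc∈ t∈ = ∈-++⁺ʳ (rw u) (∈-++⁺ʳ (rw v) (∈-concatMap⁺ (rw ∘ proj₁) (Any.map (λ { refl → t∈ }) wc∈)))

  reduced-word : ∀ w → InSZ+ w → ∃ (_∈ rw w)
  reduced-word w w∈S with rw w in eq
  ... | t ∷ _ = t , here refl
  -- Emptiness of the list `rw w` is decided, so the double negation suffices.
  ... | []    = ⊥-elim (reduced-word-¬¬ w w∈S (λ t r → empty (subst (t ∈_) eq (proj₂ (exact w t) r))))
    where
    empty : ∀ {t : Word} → t ∉ []
    empty ()

  weaken : ∀ {ts : List Word} → All (λ t → length t ℕ.≤ B) ts → All (λ t → length t ℕ.≤ l) ts
  weaken = All.map (λ h → ℕ.≤-trans h (ℕ.m≤m+n B B))

  p+q≤l : IᵢSet i (rw u) ℕ.+ IᵢSet i (rw v) ℕ.≤ l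
  p+q≤l = ℕ.+-mono-≤ (IᵢSet-≤ i (short sub-u)) (IᵢSet-≤ i (short sub-v))

  open Theorem u v (admissible sub-u) (admissible sub-v) _ _
    (proj₂ (reduced-word u u∈S)) (proj₂ (reduced-word v v∈S))
    (weaken (short sub-u)) (weaken (short sub-v)) L distinct expansion
    (All.tabulate (λ wc∈ → admissible (sub-L wc∈)))
    p+q≤l (ℕ.≤-trans p+q≤l (ℕ.≤-trans (proj₁ (proj₂ i-bounds)) (ℕ.n≤1+n _)))
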